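{- Let $\xi\ge1$ be a countable ordinal, and let $B\in\Pi^0_{\xi+1}(2^\omega)$ (lightface). Then there are $C\in\Pi^0_1(\omega^\omega)$ (lightface), a partial function $f:\omega^\omega\to2^\omega$ which is recursive on $C$, and a partial function $g:2^\omega\to\omega^\omega$ which is $\Sigma^0_\xi$-recursive on $B$, such that $f$ defines a bijection from $C$ onto $B$ and $g$ coincides with $f^{ -1}$ (on $B$).
   Context: Effective notions (recursively presented Polish spaces, recursive functions) are those of Moschovakis' book "Descriptive Set Theory". Each recursively presented Polish space $X$ has its standard effective enumeration $(N(X,k))_{k\in\omega}$ of a neighbourhood basis (possibly with empty sets; $N(X,0)=\emptyset$). $X$ is of type at most $1$ if it is a finite product of spaces equal to $\omega$, $\omega^\omega$ or $2^\omega$. $B\in\Sigma^0_1(X)$ iff $B=\bigcup_{i}N(X,\varepsilon(i))$ for some recursive $\varepsilon:\omega\to\omega$; $\gamma\in\omega^\omega$ is $\Sigma^0_1$ (i.e. recursive) iff $\{k\mid\gamma\in N(\omega^\omega,k)\}\in\Sigma^0_1(\omega)$. Fix a good parametrization: sets $G^X\in\Sigma^0_1(\omega^\omega\times X)$, one for each recursively presented Polish $X$, such that $P\subseteq X$ is open iff $P=G^X_\gamma$ for some $\gamma\in\omega^\omega$, $P$ is $\Sigma^0_1$ iff $P=G^X_\gamma$ for some recursive $\gamma$, and for $X$ of type at most 1 and any $Y$ there is a recursive $S^{X,Y}:\omega^\omega\times X\to\omega^\omega$ with $(\gamma,x,y)\in G^{X\times Y}\Leftrightarrow(S^{X,Y}(\gamma,x),y)\in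 G^Y$. For $\gamma\in\omega^\omega$, $\{\gamma\}^{X,Y}$ is the partial function from $X$ to $Y$ with $\{\gamma\}^{X,Y}(x)$ defined and equal to $y$ iff $y$ is the (unique) point with $\forall k\,[y\in N(Y,k)\Leftrightarrow(\gamma,x,k)\in G^{X\times\omega}]$; write $\{\gamma\}$ when $Y=\omega^\omega$. Borel codes: let $\gamma^*(i):=\gamma(i+1)$. $BC_1:=\{\gamma\in\omega^\omega\mid\gamma(0)=0\}$ and for $2\le\xi<\omega_1$, $BC_\xi:=\{\gamma\in\omega^\omega\mid\gamma(0)=1$ and $\forall i\in\omega$, $\{\gamma^*\}(i)$ is defined and in $\bigcup_{1\le\eta<\xi}BC_\eta\}$; $BC:=\bigcup_{1\le\xi<\omega_1}BC_\xi$. For $\gamma\in BC$, $\rho^X(\gamma):=\bigcup_iN(X,\gamma^*(i))$ if $\gamma\in BC_1$, and $\rho^X(\gamma):=\bigcup_iX\setminus\rho^X(\{\gamma^*\}(i))$ otherwise. For $1\le\xi<\omega_1$ the lightface classes are $\Sigma^0_\xi(X):=\{\rho^X(\gamma)\mid\gamma\in\Sigma^0_1\cap BC_\xi\}$, and $\Pi^0_\xi$ is the class of complements of $\Sigma^0_\xi$ sets. For a partial function $f:X\to Y$ and $D\subseteq\mathrm{Domain}(f)$, a set $P\subseteq X\times\omega$ computes $f$ on $D$ if for all $x\in D$ and $k\in\omega$, $f(x)\in N(Y,k)\Leftrightarrow(x,k)\in P$. For a lightface pointclass $\Gamma$, $f$ is $\Gamma$-recursive on $D$ if some $P\in\Gamma$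 computes $f$ on $D$; "recursive on $D$" means $\Sigma^0_1$-recursive on $D$. -}

module Defs where

open import Data.Bool using (Bool; true; false)
open import Data.Fin using (Fin)
open import Data.Nat using (ℕ; zero; suc; _*_; _≤_; _<_)
open import Data.Product using (Σ; Σ-syntax; ∃; ∃-syntax; _×_; _,_; proj₁; proj₂)
open import Data.Vec using (Vec; _∷_; head; lookup; tabulate)
open import Function.Base using (const; _∘_)
open import Function.Bundles using (_⇔_; _↣_)
open import Induction.WellFounded using (WellFounded)
open import Level using (Level; 0ℓ; _⊔_) renaming (suc to lsuc)
open import Relation.Binary.Core using (Rel)
open import Relation.Binary.PropositionalEquality using (_≡_; _≢_; _≗_)
open import Relation.Binary.Structures using (IsStrictTotalOrder)
open import Relation.Nullary using (¬_)
open import Relation.Unary using (Pred; _∈_; _⊆_; _≐_; ∁)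

private
  variable
    ℓ : Level
    m n : ℕ

primRec : (Vec ℕ n → ℕ) → (Vec ℕ (suc (suc n)) → ℕ) → Vec ℕ (suc n) → ℕ
primRec g h (zero  ∷ xs) = g xs
primRec g h (suc k ∷ xs) = h (k ∷ primRec g h (k ∷ xs) ∷ xs)

-- Minimalization is only applied when it yields a total function:
-- f xs is the least y with g (y ∷ xs) ≡ 0.  The constructor ext is
-- needed because pointwise equal functions need not be equal in Agda.

data Recursive : (Vec ℕ n → ℕ) → Set where
  constant   : (w : ℕ) → Recursive {n} (const w)
  successor  : Recursive {1} (suc ∘ head)
  projection : (i : Fin n) → Recursive (λ xs → lookup xs i)
  compose    : {g : Vec ℕ m → ℕ} {fs : Fin m → Vec ℕ n → ℕ} →
               Recursive g → (∀ i → Recursive (fs i)) →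
               Recursive (λ xs → g (tabulate (λ i → fs i xs)))
  recursion  : {g : Vec ℕ n → ℕ} {h : Vec ℕ (suc (suc n)) → ℕ} →
               Recursive g → Recursive h → Recursive (primRec g h)
  minimize   : {g : Vec ℕ (suc n) → ℕ} {f : Vec ℕ n → ℕ} →
               Recursive g →
               (∀ xs → g (f xs ∷ xs) ≡ 0) →
               (∀ xs y → y < f xs → g (y ∷ xs) ≢ 0) →
               Recursive f
  ext        : {f g : Vec ℕ n → ℕ} → f ≗ g → Recursive f → Recursive g

-- unpair is the Cantor bijection from ℕ onto ℕ × ℕ, which walks along the
-- diagonals: (0,0), (0,1), (1,0), (0,2), (1,1), (2,0), …

nextPair : ℕ × ℕ → ℕ × ℕ
nextPair (x , zero)  = zero , suc x
nextPair (x , suc y) = suc x , y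

unpair : ℕ → ℕ × ℕ
unpair zero    = zero , zero
unpair (suc s) = nextPair (unpair s)

-- s ! i is the component (s)_i of the sequence coded by s.  Every s codes
-- an eventually zero sequence, every eventually zero sequence has a code,
-- and 0 codes the zero sequence.

infixl 8 _!_

_!_ : ℕ → ℕ → ℕ
s ! zero  = proj₁ (unpair s)
s ! suc i = proj₂ (unpair s) ! i

infixr 5 _⊗_

data Space : Set where
  ω 𝒩 𝒞 : Space
  _⊗_   : Space → Space → Space

Baire : Set
Baire = ℕ → ℕ

El : Space → Set
El ω       = ℕ
El 𝒩       = Baire
El 𝒞       = ℕ → Bool
El (X ⊗ Y) = El X × El Y

-- Equality of points; sequences are compared pointwise.

Eq : (X : Space) → Rel (El X) 0ℓ
Eq ω       m n             = m ≡ n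
Eq 𝒩       α β             = α ≗ β
Eq 𝒞       α β             = α ≗ β
Eq (X ⊗ Y) (x , y) (x′ , y′) = Eq X x x′ × Eq Y y y′

isPositive : ℕ → Bool
isPositive zero    = false
isPositive (suc _) = true

-- On a factor ω, 𝒩 or 𝒞, N X s is the open ball with centre r_{(s)_0} and
-- radius (s)_1 / ((s)_2 + 1).  Here r_i is i on ω, the sequence (i)_n on 𝒩
-- and its truncation to {0,1} on 𝒞.  Distinct points of ω have distance 1;
-- distinct sequences have distance 1 / (n + 1), where n is the first place
-- at which they differ.  So a point belongs to the ball iff the radius is
-- positive and there is no difference at a place n with
-- (s)_1 / ((s)_2 + 1) ≤ 1 / (n + 1).  In particular N X 0 is empty.

N : (X : Space) → ℕ → Pred (El X) 0ℓ
N ω       s x = 0 < s ! 1 × (s ! 1 ≤ suc (s ! 2) → x ≡ s ! 0)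
N 𝒩       s α = 0 < s ! 1 × (∀ n → s ! 1 * suc n ≤ suc (s ! 2) → α n ≡ (s ! 0) ! n)
N 𝒞       s α = 0 < s ! 1 × (∀ n → s ! 1 * suc n ≤ suc (s ! 2) → α n ≡ isPositive ((s ! 0) ! n))
N (X ⊗ Y) s (x , y) = N X (s ! 0) x × N Y (s ! 1) y

Pointclass : (ℓ : Level) → Set (lsuc 0ℓ ⊔ lsuc ℓ)
Pointclass ℓ = (X : Space) → Pred (Pred (El X) 0ℓ) ℓ

Open : Pointclass 0ℓ
Open X P = ∀ {x} → x ∈ P → ∃[ k ] x ∈ N X k × N X k ⊆ P

Σ⁰₁ : Pointclass 0ℓ
Σ⁰₁ X P = ∃[ ε ] Recursive {1} (ε ∘ head) × P ≐ (λ x → ∃[ i ] x ∈ N X (ε i))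

Co : Pointclass ℓ → Pointclass (lsuc 0ℓ ⊔ ℓ)
Co Γ X P = ∃[ Q ] Γ X Q × P ≐ ∁ Q

Π⁰₁ : Pointclass (lsuc 0ℓ)
Π⁰₁ = Co Σ⁰₁

RecursivePoint : (X : Space) → Pred (El X) 0ℓ
RecursivePoint X x = Σ⁰₁ ω (λ k → x ∈ N X k)

RecursiveMap : (X Y : Space) → Pred (El X → El Y) 0ℓ
RecursiveMap X Y f = Σ⁰₁ (X ⊗ ω) (λ (x , k) → f x ∈ N Y k)

record GoodParametrization : Set₁ where
  field
    G   : (X : Space) → Pred (El (𝒩 ⊗ X)) 0ℓ
    S   : (X Y : Space) → El (𝒩 ⊗ X) → Baire

  section : (X : Space) → Baire → Pred (El X) 0ℓ
  section X γ x = (γ , x) ∈ G X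

  field
    G-Σ⁰₁       : ∀ X → Σ⁰₁ (𝒩 ⊗ X) (G X)
    G-open      : ∀ X (P : Pred (El X) 0ℓ) →
                  Open X P ⇔ (∃[ γ ] P ≐ section X γ)
    G-recursive : ∀ X (P : Pred (El X) 0ℓ) →
                  Σ⁰₁ X P ⇔ (∃[ γ ] RecursivePoint 𝒩 γ × P ≐ section X γ)
    S-recursive : ∀ X Y → RecursiveMap (𝒩 ⊗ X) 𝒩 (S X Y)
    S-section   : ∀ X Y γ x y →
                  (γ , x , y) ∈ G (X ⊗ Y) ⇔ (S X Y (γ , x) , y) ∈ G Y

  -- Apply X Y γ x y: {γ}^{X,Y} is defined at x with value y.  There is at
  -- most one such y up to Eq Y, because the sets N Y k separate points.

  Apply : (X Y : Space) → Baire → El X → El Y → Set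
  Apply X Y γ x y = ∀ k → y ∈ N Y k ⇔ (γ , x , k) ∈ G (X ⊗ ω)

-- An element of a countable well-order stands for the order type of the
-- set of its predecessors.  All countable ordinals arise in this way, and
-- the order of the elements is the order of the ordinals they stand for.

record CountableWellOrder : Set₁ where
  infix 4 _≺_
  field
    Carrier            : Set
    _≺_                : Rel Carrier 0ℓ
    isStrictTotalOrder : IsStrictTotalOrder _≡_ _≺_
    wellFounded        : WellFounded _≺_
    countable          : Carrier ↣ ℕ

  1≼_ : Pred Carrier 0ℓ
  1≼ ξ = ∃[ η ] η ≺ ξ

  2≼_ : Pred Carrier 0ℓ
  2≼ ξ = ∃[ η ] 1≼ η × η ≺ ξ

  IsSuccessor : Rel Carrier 0ℓ
  IsSuccessor ξ ξ⁺ = ξ ≺ ξ⁺ × (∀ {η} → η ≺ ξ⁺ → ¬ ξ ≺ η)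

infix 9 _⋆

_⋆ : Baire → Baire
(γ ⋆) i = γ (suc i)

module Borel (𝒢 : GoodParametrization) (Λ : CountableWellOrder) where
  open GoodParametrization 𝒢
  open CountableWellOrder Λ

  -- Since each index refers only to smaller indices of a well-order, this
  -- inductive family is the one defined by transfinite recursion on ξ.

  data BC (ξ : Carrier) (γ : Baire) : Set where
    basic : 1≼ ξ → ¬ 2≼ ξ → γ 0 ≡ 0 → BC ξ γ
    union : 2≼ ξ → γ 0 ≡ 1 →
            (δ : ℕ → Baire) (η : ℕ → Carrier) →
            (∀ i → Apply ω 𝒩 (γ ⋆) i (δ i)) →
            (∀ i → 1≼ η i × η i ≺ ξ) →
            (∀ i → BC (η i) (δ i)) →
            BC ξ γ

  -- Up to extensional equality, the set coded by γ does not depend on the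
  -- proof that γ is a code: γ 0 determines the constructor, and the γ ⋆
  -- computation determines the codes δ i.

  ρ : (X : Space) {ξ : Carrier} {γ : Baire} → BC ξ γ → Pred (El X) 0ℓ
  ρ X {γ = γ} (basic _ _ _)       x = ∃[ i ] x ∈ N X ((γ ⋆) i)
  ρ X         (union _ _ _ _ _ _ c) x = ∃[ i ] ¬ (x ∈ ρ X (c i))

  Σ⁰ : Carrier → Pointclass 0ℓ
  Σ⁰ ξ X P = ∃[ γ ] RecursivePoint 𝒩 γ × Σ[ c ∈ BC ξ γ ] P ≐ ρ X c

  Π⁰ : Carrier → Pointclass (lsuc 0ℓ)
  Π⁰ ξ = Co (Σ⁰ ξ)

record PartialFunction (X Y : Space) : Set₁ where
  field
    Domain      : Pred (El X) 0ℓ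
    apply       : ∀ {x} → x ∈ Domain → El Y
    Domain-resp : ∀ {x x′} → Eq X x x′ → x ∈ Domain → x′ ∈ Domain
    apply-cong  : ∀ {x x′} (p : x ∈ Domain) (p′ : x′ ∈ Domain) →
                  Eq X x x′ → Eq Y (apply p) (apply p′)

open PartialFunction public using (Domain; apply)

module _ {X Y : Space} (f : PartialFunction X Y) where

  Computes : {D : Pred (El X) 0ℓ} → D ⊆ Domain f → Pred (El (X ⊗ ω)) 0ℓ → Set
  Computes {D} D⊆ P = ∀ {x} (x∈D : x ∈ D) k → apply f (D⊆ x∈D) ∈ N Y k ⇔ (x , k) ∈ P

  RecursiveOn : Pointclass ℓ → {D : Pred (El X) 0ℓ} → D ⊆ Domain f → Set (lsuc 0ℓ ⊔ ℓ)
  RecursiveOn Γ D⊆ = ∃[ P ] Γ (X ⊗ ω) P × Computes D⊆ P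

  record BijectionOnto {C : Pred (El X) 0ℓ} (C⊆ : C ⊆ Domain f) (B : Pred (El Y) 0ℓ) : Set where
    field
      maps-to    : ∀ {x} (x∈C : x ∈ C) → apply f (C⊆ x∈C) ∈ B
      injective  : ∀ {x x′} (x∈C : x ∈ C) (x′∈C : x′ ∈ C) →
                   Eq Y (apply f (C⊆ x∈C)) (apply f (C⊆ x′∈C)) → Eq X x x′
      surjective : ∀ {y} → y ∈ B → ∃[ x ] Σ[ x∈C ∈ x ∈ C ] Eq Y (apply f (C⊆ x∈C)) y

  InverseOn : (g : PartialFunction Y X) {C : Pred (El X) 0ℓ} {B : Pred (El Y) 0ℓ} →
              C ⊆ Domain f → B ⊆ Domain g → Set
  InverseOn g {C} {B} C⊆ B⊆ =
    ∀ {x y} (x∈C : x ∈ C) (y∈B : y ∈ B) →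
    Eq Y (apply f (C⊆ x∈C)) y → Eq X (apply g (B⊆ y∈B)) x

-- Write the complement of B as ρ(γ) for a recursive Borel code γ, and complete the tree of γ by giving every
-- basic node, which codes a union of basic neighbourhoods, their complements as children. Then each set of
-- the tree is the union of the complements of its children. Label every node below the root, at a point x, by 0 if x
-- is not in its set and by j + 1 if the j-th child is the first one that omits x. The sequence α of the bits
-- of x and of all labels is determined by x, and the conditions for α to be such a sequence for a point of B are
-- closed (labels are the witnesses of the existential quantifiers), so they define C, and f reads x off α.
--
-- For the inverse, a label at a point of B is a recursive function of the memberships of x in the sets below
-- the top level, which have rank less than ξ. So g(x) ∈ N(k) holds iff x avoids one of a recursive sequence
-- of finite unions of such sets and a complement of a basic neighbourhood; codes of them are found with the
-- recursion theorem. If ξ = 1, all nodes are basic and these memberships are recursive in x.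

module Submission where

open import Defs
open import Axiom.ExcludedMiddle using (ExcludedMiddle)
open import Data.Bool using (Bool; true; false)
open import Data.Empty using (⊥-elim)
open import Data.Fin using (Fin; zero; suc; toℕ)
open import Data.Nat
open import Data.Nat.Induction using (<-rec)
open import Data.Nat.Properties
open import Data.Product using (Σ-syntax; ∃; ∃-syntax; _×_; _,_; proj₁; proj₂)
open import Data.Sum using (_⊎_; inj₁; inj₂; [_,_]′)
open import Data.Unit using (⊤; tt)
open import Data.Vec using (Vec; []; _∷_; head; tail; lookup; tabulate)
open import Data.Vec.Properties using (tabulate∘lookup; tabulate-cong)
open import Function.Base using (_∘_; id)
open import Function.Bundles using (_⇔_; mk⇔; Equivalence)
open import Induction.WellFounded using (Acc; acc)
open import Level using (0ℓ)
open import Relation.Binary using (tri<; tri≈; tri>)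
open import Relation.Binary.PropositionalEquality
open import Relation.Binary.Structures using (IsStrictTotalOrder)
open import Relation.Nullary using (¬_; Dec; yes; no; does)
open import Relation.Nullary.Decidable using (decidable-stable; toSum)
open import Relation.Unary using (Pred; _⊆_)

-- The label of a node of rank ξ depends on memberships in its children, whose rank is less than ξ.
-- Only the label 0 needs the membership in the node's own set, and at a point of B this label
-- cannot occur at the top level. That is what brings g down to Σ⁰_ξ. Choosing the first omitting
-- child makes α unique, hence f injective. The inverse has to express finitely many memberships by
-- one avoided set. Nonmembership is avoidance of the set itself; membership is avoidance of some
-- child, guessed by an existential quantifier; and avoiding several sets is avoiding their union.
-- This union must again be a union of complements of sets of smaller rank, with a recursive code.
-- Ranks are not computable, so the code is built from the tree alone: whether a union node is among
-- the listed nodes is decidable and selects the form of the code. Its rank is bounded only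
-- afterwards, by well-founded induction.

private
  variable
    n : ℕ
    f g : Vec ℕ n → ℕ

-- Recursive functions of numbers

record Recursive₁ (h : ℕ → ℕ) : Set where
  constructor mk₁
  field recursive₁ : Recursive {1} (λ v → h (lookup v zero))

record Recursive₂ (h : ℕ → ℕ → ℕ) : Set where
  constructor mk₂
  field recursive₂ : Recursive {2} (λ v → h (lookup v zero) (lookup v (suc zero)))

record Recursive₃ (h : ℕ → ℕ → ℕ → ℕ) : Set where
  constructor mk₃
  field recursive₃ : Recursive {3} (λ v → h (lookup v zero) (lookup v (suc zero)) (lookup v (suc (suc zero))))

#0 : Recursive {suc n} (λ v → lookup v zero)
#0 = projection zero

#1 : Recursive {suc (suc n)} (λ v → lookup v (suc zero))
#1 = projection (suc zero)

#2 : Recursive {suc (suc (suc n))} (λ v → lookup v (suc (suc zero)))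
#2 = projection (suc (suc zero))

#3 : Recursive {suc (suc (suc (suc n)))} (λ v → lookup v (suc (suc (suc zero))))
#3 = projection (suc (suc (suc zero)))

apply₁ : {h : ℕ → ℕ} → Recursive₁ h → Recursive f → Recursive (λ v → h (f v))
apply₁ (mk₁ H) F = compose H (λ _ → F)

apply₂ : {h : ℕ → ℕ → ℕ} → Recursive₂ h → Recursive f → Recursive g →
         Recursive (λ v → h (f v) (g v))
apply₂ {f = f} {g = g} (mk₂ H) F G =
  compose {fs = λ { zero → f ; (suc _) → g }} H λ { zero → F ; (suc zero) → G }

compose-head : ∀ {n m} {f : Vec ℕ (suc n) → ℕ} {g : Vec ℕ m → ℕ} →
               Recursive f → Recursive g → (ρ : Fin n → Fin m) →
               Recursive (λ v → f (g v ∷ tabulate (lookup v ∘ ρ)))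
compose-head {n} {m} {g = g} F G ρ =
  compose {fs = fs} F λ { zero → G ; (suc i) → projection (ρ i) }
  where
  fs : Fin (suc n) → Vec ℕ m → ℕ
  fs zero    = g
  fs (suc i) v = lookup v (ρ i)

substitute : {f : Vec ℕ (suc n) → ℕ} {g : Vec ℕ n → ℕ} →
             Recursive f → Recursive g → Recursive (λ v → f (g v ∷ v))
substitute {f = f} {g} F G =
  ext (λ v → cong (λ w → f (g v ∷ w)) (tabulate∘lookup v)) (compose-head F G id)

suc-recursive : Recursive₁ suc
suc-recursive = mk₁ (ext (λ { (_ ∷ []) → refl }) successor)

primRec₁ : {F : ℕ → ℕ} {h : ℕ → ℕ → ℕ} → Recursive₂ h →
           (∀ x → F (suc x) ≡ h x (F x)) → Recursive₁ F
primRec₁ {F} {h} (mk₂ H) F-suc = mk₁ (ext (λ { (x ∷ []) → eq x }) (recursion (constant (F 0)) H))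
  where
  eq : ∀ x → primRec (λ _ → F 0) (λ v → h (lookup v zero) (lookup v (suc zero))) (x ∷ []) ≡ F x
  eq zero    = refl
  eq (suc x) = trans (cong (h x) (eq x)) (sym (F-suc x))

primRec₂ : {F : ℕ → ℕ → ℕ} {g : ℕ → ℕ} {h : ℕ → ℕ → ℕ → ℕ} → Recursive₁ g → Recursive₃ h →
           (∀ y → F 0 y ≡ g y) → (∀ x y → F (suc x) y ≡ h x (F x y) y) → Recursive₂ F
primRec₂ {F} {g} {h} (mk₁ G) (mk₃ H) F-zero F-suc =
  mk₂ (ext (λ { (x ∷ y ∷ []) → eq x y }) (recursion G H))
  where
  eq : ∀ x y → primRec (λ v → g (lookup v zero))
                       (λ v → h (lookup v zero) (lookup v (suc zero)) (lookup v (suc (suc zero))))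
                       (x ∷ y ∷ []) ≡ F x y
  eq zero    y = sym (F-zero y)
  eq (suc x) y = trans (cong (λ r → h x r y) (eq x y)) (sym (F-suc x y))

swap-recursive : {h : ℕ → ℕ → ℕ} → Recursive₂ h → Recursive₂ (λ x y → h y x)
swap-recursive H = mk₂ (apply₂ H #1 #0)

+-recursive : Recursive₂ _+_
+-recursive = primRec₂ {h = λ _ r _ → suc r} (mk₁ #0) (mk₃ (apply₁ suc-recursive #1)) (λ _ → refl) (λ _ _ → refl)

*-recursive : Recursive₂ _*_
*-recursive = primRec₂ {g = λ _ → 0} {λ _ r y → y + r} (mk₁ (constant 0)) (mk₃ (apply₂ +-recursive #2 #1))
                (λ _ → refl) (λ _ _ → refl)

pred-recursive : Recursive₁ pred
pred-recursive = primRec₁ {h = λ x _ → x} (mk₂ #0) (λ _ → refl)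

∸-recursive : Recursive₂ _∸_
∸-recursive = swap-recursive (primRec₂ {h = λ _ r _ → pred r} (mk₁ #0) (mk₃ (apply₁ pred-recursive #1))
                (λ _ → refl) (λ x y → sym (pred[m∸n]≡m∸[1+n] y x)))

infixl 6 _+ᴿ_ _∸ᴿ_
infixl 7 _*ᴿ_

_+ᴿ_ : Recursive f → Recursive g → Recursive (λ v → f v + g v)
_+ᴿ_ = apply₂ +-recursive

_*ᴿ_ : Recursive f → Recursive g → Recursive (λ v → f v * g v)
_*ᴿ_ = apply₂ *-recursive

_∸ᴿ_ : Recursive f → Recursive g → Recursive (λ v → f v ∸ g v)
_∸ᴿ_ = apply₂ ∸-recursive

sucᴿ : Recursive f → Recursive (λ v → suc (f v))
sucᴿ = apply₁ suc-recursive

if0 : ℕ → ℕ → ℕ → ℕ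
if0 zero    x y = x
if0 (suc _) x y = y

if0ᴿ : {c : Vec ℕ n → ℕ} → Recursive c → Recursive f → Recursive g →
       Recursive (λ v → if0 (c v) (f v) (g v))
if0ᴿ {f = f} {g} {c} C F G = ext eq ((constant 1 ∸ᴿ C) *ᴿ F +ᴿ (constant 1 ∸ᴿ (constant 1 ∸ᴿ C)) *ᴿ G)
  where
  eq : ∀ v → (1 ∸ c v) * f v + (1 ∸ (1 ∸ c v)) * g v ≡ if0 (c v) (f v) (g v)
  eq v with c v
  ... | zero  = trans (+-identityʳ (f v + 0)) (+-identityʳ (f v))
  ... | suc k rewrite 0∸n≡0 k = +-identityʳ (g v)

-- The Cantor pairing

triangle : ℕ → ℕ
triangle zero    = 0
triangle (suc n) = suc (n + triangle n)

triangle-recursive : Recursive₁ triangle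
triangle-recursive = primRec₁ {h = λ x r → suc (x + r)} (mk₂ (sucᴿ (#0 +ᴿ #1))) (λ _ → refl)

fst snd : ℕ → ℕ
fst s = proj₁ (unpair s)
snd s = proj₂ (unpair s)

diagonal : ℕ → ℕ
diagonal s = fst s + snd s

-- Diagonal d begins at position `triangle d`, and `fst` counts the steps along it. The case split
-- follows `nextPair`: a pair with second component 0 is the last of its diagonal.
triangle-diagonal : ∀ s → s ≡ triangle (diagonal s) + fst s
triangle-diagonal zero = refl
triangle-diagonal (suc s) with unpair s | triangle-diagonal s
... | x , zero  | eq rewrite +-identityʳ x = let open ≡-Reasoning in begin
  suc s                      ≡⟨ cong suc eq ⟩
  suc (triangle x + x)       ≡⟨ cong suc (+-comm (triangle x) x) ⟩
  suc (x + triangle x)       ≡⟨ +-identityʳ _ ⟨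
  suc (x + triangle x) + 0   ∎
... | x , suc y | eq rewrite +-suc x y = trans (cong suc eq) (sym (+-suc _ x))

fst-diagonal : ∀ s → fst s ≡ s ∸ triangle (diagonal s)
fst-diagonal s = sym (trans (cong (_∸ triangle (diagonal s)) (triangle-diagonal s)) (m+n∸m≡n (triangle (diagonal s)) (fst s)))

snd-diagonal : ∀ s → snd s ≡ diagonal s ∸ fst s
snd-diagonal s = sym (m+n∸m≡n (fst s) (snd s))

-- `diagonal` grows exactly when `snd s` is 0. Recursiveness of `fst` and `snd` is derived from this
-- lemma, so the step recovers both from s and the current diagonal r.
diagonal-recursive : Recursive₁ diagonal
diagonal-recursive = primRec₁ {h = λ x r → r + (1 ∸ (r ∸ (x ∸ triangle r)))} 
  (mk₂ (#1 +ᴿ (constant 1 ∸ᴿ (#1 ∸ᴿ (#0 ∸ᴿ apply₁ triangle-recursive #1))))) step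
  where
  step : ∀ s → diagonal (suc s) ≡ diagonal s + (1 ∸ (diagonal s ∸ (s ∸ triangle (diagonal s))))
  step s rewrite sym (fst-diagonal s) | sym (snd-diagonal s) with unpair s
  ... | x , zero  = trans (cong suc (sym (+-identityʳ x))) (+-comm 1 (x + 0))
  ... | x , suc y rewrite 0∸n≡0 y = trans (sym (+-suc x y)) (sym (+-identityʳ (x + suc y)))

fst-recursive : Recursive₁ fst
fst-recursive = mk₁ (ext (λ { (s ∷ []) → sym (fst-diagonal s) })
  (#0 ∸ᴿ apply₁ triangle-recursive (apply₁ diagonal-recursive #0)))

snd-recursive : Recursive₁ snd
snd-recursive = mk₁ (ext (λ { (s ∷ []) → sym (snd-diagonal s) })
  (apply₁ diagonal-recursive #0 ∸ᴿ apply₁ fst-recursive #0))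

opaque
  pair : ℕ → ℕ → ℕ
  pair x y = triangle (x + y) + x

  pair-recursive : Recursive₂ pair
  pair-recursive = mk₂ (apply₁ triangle-recursive (#0 +ᴿ #1) +ᴿ #0)

  unpair-pair : ∀ x y → unpair (pair x y) ≡ (x , y)
  unpair-pair x y = go (x + y) x y refl
    where
    -- The walk is traced backwards: (x + 1, y) comes from (x, y + 1), and (0, y + 1) from (y, 0) on
    -- the previous diagonal, where d decreases.
    go : ∀ d x y → x + y ≡ d → unpair (triangle (x + y) + x) ≡ (x , y)
    go d (suc x) y eq =
      cong nextPair (trans (cong unpair shift) (go d x (suc y) (trans (+-suc x y) eq)))
      where
      shift : x + y + triangle (x + y) + suc x ≡ triangle (x + suc y) + x
      shift = trans (+-suc (x + y + triangle (x + y)) x)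
                    (cong (λ d → triangle d + x) (sym (+-suc x y)))
    go (suc d) zero (suc y) eq = cong nextPair (trans (cong unpair lemma) (go d y zero (trans (+-identityʳ y) (suc-injective eq))))
      where
      lemma : y + triangle y + 0 ≡ triangle (y + 0) + y
      lemma = trans (+-identityʳ _) (trans (+-comm y (triangle y)) (cong (λ z → triangle z + y) (sym (+-identityʳ y))))
    go d zero zero eq = refl

  pair-unpair : ∀ s → pair (fst s) (snd s) ≡ s
  pair-unpair s = sym (triangle-diagonal s)

fst-pair : ∀ x y → fst (pair x y) ≡ x
fst-pair x y = cong proj₁ (unpair-pair x y)

snd-pair : ∀ x y → snd (pair x y) ≡ y
snd-pair x y = cong proj₂ (unpair-pair x y)

-- A node number below the top level is a pair whose first component is the parent's number plus
-- one, so this bound makes recursion on parents well founded.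
fst≤ : ∀ s → fst s ≤ s
fst≤ s = subst (fst s ≤_) (sym (triangle-diagonal s)) (m≤n+m (fst s) (triangle (diagonal s)))

pairᴿ : Recursive f → Recursive g → Recursive (λ v → pair (f v) (g v))
pairᴿ = apply₂ pair-recursive

fstᴿ : Recursive f → Recursive (λ v → fst (f v))
fstᴿ = apply₁ fst-recursive

sndᴿ : Recursive f → Recursive (λ v → snd (f v))
sndᴿ = apply₁ snd-recursive

-- Sequence codes

-- `_!_` changes the sequence during its recursion; iterating `snd` on a fixed sequence fits the
-- primitive recursion scheme.
drop! : ℕ → ℕ → ℕ
drop! zero    s = s
drop! (suc i) s = snd (drop! i s)

drop!-snd : ∀ i s → drop! i (snd s) ≡ snd (drop! i s)
drop!-snd zero    s = refl
drop!-snd (suc i) s = cong snd (drop!-snd i s)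

!-drop! : ∀ i s → s ! i ≡ fst (drop! i s)
!-drop! zero    s = refl
!-drop! (suc i) s = trans (!-drop! i (snd s)) (cong fst (drop!-snd i s))

!-recursive : Recursive₂ _!_
!-recursive = mk₂ (ext (λ { (s ∷ i ∷ []) → sym (!-drop! i s) }) (fstᴿ (apply₂ drop!-recursive #1 #0)))
  where
  drop!-recursive : Recursive₂ drop!
  drop!-recursive = primRec₂ {h = λ _ r _ → snd r} (mk₁ #0) (mk₃ (sndᴿ #1)) (λ _ → refl) (λ _ _ → refl)

infixl 8 _!ᴿ_

_!ᴿ_ : Recursive f → Recursive g → Recursive (λ v → f v ! g v)
_!ᴿ_ = apply₂ !-recursive

infixr 5 _▸_ _▸ᴿ_

_▸_ : ℕ → ℕ → ℕ
_▸_ = pair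

_▸ᴿ_ : Recursive f → Recursive g → Recursive (λ v → f v ▸ g v)
_▸ᴿ_ = pairᴿ

▸-zero : ∀ a s → (a ▸ s) ! 0 ≡ a
▸-zero = fst-pair

▸-suc : ∀ a s i → (a ▸ s) ! suc i ≡ s ! i
▸-suc a s i = cong (λ t → t ! i) (snd-pair a s)

▸-one : ∀ a b s → (a ▸ b ▸ s) ! 1 ≡ b
▸-one a b s = trans (▸-suc a _ 0) (▸-zero b s)

▸-two : ∀ a b c s → (a ▸ b ▸ c ▸ s) ! 2 ≡ c
▸-two a b c s = trans (▸-suc a _ 1) (▸-one b c s)

code-prefix : (f : ℕ → ℕ) (d : ℕ) → ∃[ c ] (∀ {n} → n < d → c ! n ≡ f n)
code-prefix f zero = 0 , λ ()
code-prefix f (suc d) with code-prefix (f ∘ suc) d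
... | c , eq = f 0 ▸ c , λ { {zero} _ → ▸-zero (f 0) c ; {suc n} (s≤s lt) → trans (▸-suc (f 0) c n) (eq lt) }

decode : (n : ℕ) → ℕ → Vec ℕ n
decode n s = tabulate (λ i → s ! toℕ i)

encode : Vec ℕ n → ℕ
encode []      = 0
encode (x ∷ v) = x ▸ encode v

decode-encode : (v : Vec ℕ n) → decode n (encode v) ≡ v
decode-encode []      = refl
decode-encode (x ∷ v) = cong₂ _∷_ (▸-zero x _)
  (trans (tabulate-cong (λ i → ▸-suc x (encode v) (toℕ i))) (decode-encode v))

-- Recursive predicates on tuples of numbers

sum< : ℕ → (ℕ → ℕ) → ℕ
sum< zero    f = 0
sum< (suc b) f = sum< b f + f b

sum<≡0 : ∀ b {f} → (∀ i → i < b → f i ≡ 0) → sum< b f ≡ 0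
sum<≡0 zero    _  = refl
sum<≡0 (suc b) eq rewrite eq b ≤-refl | sum<≡0 b (λ i lt → eq i (m<n⇒m<1+n lt)) = refl

sum<≡0⁻ : ∀ b {f} → sum< b f ≡ 0 → ∀ i → i < b → f i ≡ 0
sum<≡0⁻ (suc b) {f} eq i i<1+b with m<1+n⇒m<n∨m≡n i<1+b
... | inj₁ lt   = sum<≡0⁻ b (m+n≡0⇒m≡0 (sum< b f) eq) i lt
... | inj₂ refl = m+n≡0⇒n≡0 (sum< b f) eq

sum<ᴿ : {r : Vec ℕ (suc n) → ℕ} {b : Vec ℕ n → ℕ} → Recursive r → Recursive b →
        Recursive (λ v → sum< (b v) (λ i → r (i ∷ v)))
sum<ᴿ {n = n} {r} {b} R B = substitute {g = b} (ext eq (recursion {g = λ _ → 0} (constant 0) step)) B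
  where
  next : Vec ℕ (suc (suc n)) → ℕ
  next w = lookup w (suc zero) + r (lookup w zero ∷ tabulate (λ i → lookup w (suc (suc i))))
  step : Recursive next
  step = #1 +ᴿ compose-head R #0 (λ i → suc (suc i))
  eq : primRec (λ _ → 0) next ≗ (λ w → sum< (head w) (λ i → r (i ∷ tail w)))
  eq (zero  ∷ v) = refl
  eq (suc k ∷ v) = cong₂ _+_ (eq (k ∷ v)) (cong (λ w → r (k ∷ w)) (tabulate∘lookup v))

-- Truth is the value 0, so that conjunction becomes a sum, disjunction a product, and bounded
-- universal quantification a bounded sum.
record Decidableᴿ {n} (D : Vec ℕ n → Set) : Set where
  field
    char      : Vec ℕ n → ℕ
    recursive : Recursive char
    char≡0    : ∀ v → D v → char v ≡ 0
    char≡0⁻   : ∀ v → char v ≡ 0 → D v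

open Decidableᴿ

private
  variable
    D E : Vec ℕ n → Set

decᴿ : Decidableᴿ D → ∀ v → Dec (D v)
decᴿ d v with char d v ≟ 0
... | yes eq = yes (char≡0⁻ d v eq)
... | no neq = no λ p → neq (char≡0 d v p)

infixr 2 _∧ᴿ_
infixr 1 _∨ᴿ_

_∧ᴿ_ : Decidableᴿ D → Decidableᴿ E → Decidableᴿ (λ v → D v × E v)
d ∧ᴿ e = record
  { char      = λ v → char d v + char e v
  ; recursive = recursive d +ᴿ recursive e
  ; char≡0    = λ v (p , q) → cong₂ _+_ (char≡0 d v p) (char≡0 e v q)
  ; char≡0⁻   = λ v eq → char≡0⁻ d v (m+n≡0⇒m≡0 (char d v) eq) , char≡0⁻ e v (m+n≡0⇒n≡0 (char d v) eq)
  }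

_∨ᴿ_ : Decidableᴿ D → Decidableᴿ E → Decidableᴿ (λ v → D v ⊎ E v)
d ∨ᴿ e = record
  { char      = λ v → char d v * char e v
  ; recursive = recursive d *ᴿ recursive e
  ; char≡0    = λ { v (inj₁ p) → cong (_* char e v) (char≡0 d v p)
                  ; v (inj₂ q) → trans (cong (char d v *_) (char≡0 e v q)) (*-zeroʳ (char d v)) }
  ; char≡0⁻   = λ v eq → [ inj₁ ∘ char≡0⁻ d v , inj₂ ∘ char≡0⁻ e v ]′ (m*n≡0⇒m≡0∨n≡0 (char d v) eq)
  }

¬ᴿ : Decidableᴿ D → Decidableᴿ (λ v → ¬ D v)
¬ᴿ d = record
  { char      = λ v → 1 ∸ char d v
  ; recursive = constant 1 ∸ᴿ recursive d
  ; char≡0    = λ v ¬p → m≤n⇒m∸n≡0 (n≢0⇒n>0 (¬p ∘ char≡0⁻ d v))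
  ; char≡0⁻   = λ v eq p → 1+n≢0 (subst (λ c → 1 ∸ c ≡ 0) (char≡0 d v p) eq)
  }

infixr 1 _⇒ᴿ_

_⇒ᴿ_ : Decidableᴿ D → Decidableᴿ E → Decidableᴿ (λ v → D v → E v)
d ⇒ᴿ e = record
  { char      = char de
  ; recursive = recursive de
  ; char≡0    = λ v p → char≡0 de v (case v p)
  ; char≡0⁻   = λ v eq p → [ (λ ¬p → ⊥-elim (¬p p)) , (λ q → q) ]′ (char≡0⁻ de v eq)
  }
  where
  de = ¬ᴿ d ∨ᴿ e
  case : ∀ v → _ → _
  case v p with decᴿ d v
  ... | yes q = inj₂ (p q)
  ... | no ¬q = inj₁ ¬q

infix 4 _≤ᴿ_ _<ᴿ_ _≡ᴿ_

_≤ᴿ_ : Recursive f → Recursive g → Decidableᴿ (λ v → f v ≤ g v)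
_≤ᴿ_ {f = f} {g} F G = record
  { char      = λ v → f v ∸ g v
  ; recursive = F ∸ᴿ G
  ; char≡0    = λ v → m≤n⇒m∸n≡0
  ; char≡0⁻   = λ v → m∸n≡0⇒m≤n
  }

_<ᴿ_ : Recursive f → Recursive g → Decidableᴿ (λ v → f v < g v)
F <ᴿ G = sucᴿ F ≤ᴿ G

_≡ᴿ_ : Recursive f → Recursive g → Decidableᴿ (λ v → f v ≡ g v)
F ≡ᴿ G = record
  { char      = char le
  ; recursive = recursive le
  ; char≡0    = λ v eq → char≡0 le v (≤-reflexive eq , ≤-reflexive (sym eq))
  ; char≡0⁻   = λ v eq → let p , q = char≡0⁻ le v eq in ≤-antisym p q
  }
  where
  le = (F ≤ᴿ G) ∧ᴿ (G ≤ᴿ F)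

∀<ᴿ : {D : Vec ℕ (suc n) → Set} {b : Vec ℕ n → ℕ} → Recursive b → Decidableᴿ D →
      Decidableᴿ (λ v → ∀ i → i < b v → D (i ∷ v))
∀<ᴿ {b = b} B d = record
  { char      = λ v → sum< (b v) (λ i → char d (i ∷ v))
  ; recursive = sum<ᴿ (recursive d) B
  ; char≡0    = λ v p → sum<≡0 (b v) (λ i lt → char≡0 d (i ∷ v) (p i lt))
  ; char≡0⁻   = λ v eq i lt → char≡0⁻ d (i ∷ v) (sum<≡0⁻ (b v) eq i lt)
  }

weakenᴿ : {f : Vec ℕ n → ℕ} → Recursive f → Recursive {suc n} (λ w → f (tail w))
weakenᴿ {f = f} F =
  ext (λ { (i ∷ v) → cong f (tabulate∘lookup v) }) (compose F (λ i → projection (suc i)))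

bit : Bool → ℕ
bit false = 0
bit true  = 1

bit-injective : ∀ {a b} → bit a ≡ bit b → a ≡ b
bit-injective {false} {false} _ = refl
bit-injective {true}  {true}  _ = refl

isPositive-bit : ∀ b → isPositive (bit b) ≡ b
isPositive-bit false = refl
isPositive-bit true  = refl

sgn : ℕ → ℕ
sgn a = bit (isPositive a)

sgnᴿ : Recursive f → Recursive (λ v → sgn (f v))
sgnᴿ {f = f} F = ext (λ v → eq (f v)) (if0ᴿ F (constant 0) (constant 1))
  where
  eq : ∀ a → if0 a 0 1 ≡ sgn a
  eq zero    = refl
  eq (suc _) = refl

-- These are the places n at which the ball s constrains a sequence. If the radius is positive,
-- there are only finitely many.
Reaches : ℕ → ℕ → Set
Reaches s n = s ! 1 * suc n ≤ suc (s ! 2)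

reaches-bound : ∀ s {n} → 0 < s ! 1 → Reaches s n → n < suc (s ! 2)
reaches-bound s {n} pos le with s ! 1
reaches-bound s {n} (s≤s _) le | suc p = ≤-trans (m≤m+n (suc n) (p * suc n)) le

Reachesᴿ : Recursive f → Recursive g → Decidableᴿ (λ v → Reaches (f v) (g v))
Reachesᴿ F G = ((F !ᴿ constant 1) *ᴿ sucᴿ G) ≤ᴿ sucᴿ (F !ᴿ constant 2)

reaches? : ∀ s n → Dec (Reaches s n)
reaches? s n = s ! 1 * suc n ≤? suc (s ! 2)

ball : ℕ → ℕ → ℕ → ℕ
ball c p q = c ▸ p ▸ q ▸ 0

ballᴿ : {h : Vec ℕ n → ℕ} → Recursive f → Recursive g → Recursive h → Recursive (λ v → ball (f v) (g v) (h v))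
ballᴿ F G H = F ▸ᴿ G ▸ᴿ H ▸ᴿ constant 0

ball-centre : ∀ c p q → ball c p q ! 0 ≡ c
ball-centre c p q = ▸-zero c _

ball-numerator : ∀ c p q → ball c p q ! 1 ≡ p
ball-numerator c p q = ▸-one c p _

ball-denominator : ∀ c p q → ball c p q ! 2 ≡ q
ball-denominator c p q = ▸-two c p q 0

reaches-unit : ∀ c q {n} → n ≤ q → Reaches (ball c 1 q) n
reaches-unit c q {n} n≤q rewrite ball-numerator c 1 q | ball-denominator c 1 q =
  s≤s (subst (_≤ q) (sym (+-identityʳ n)) n≤q)

reaches-unit⁻ : ∀ c q {n} → Reaches (ball c 1 q) n → n ≤ q
reaches-unit⁻ c q {n} r rewrite ball-numerator c 1 q | ball-denominator c 1 q =
  subst (_≤ q) (+-identityʳ n) (s≤s⁻¹ r)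

-- Balls of 𝒩 (val = id) and of 𝒞 (val = sgn) at once; val reads off the entries of the centre.

SeqBall : (ℕ → ℕ) → ℕ → Baire → Set
SeqBall val s α = 0 < s ! 1 × (∀ n → Reaches s n → α n ≡ val ((s ! 0) ! n))

N𝒞⇒SeqBall : ∀ s {x} → N 𝒞 s x → SeqBall sgn s (bit ∘ x)
N𝒞⇒SeqBall s (pos , eq) = pos , λ n r → cong bit (eq n r)

SeqBall⇒N𝒞 : ∀ s {x} → SeqBall sgn s (bit ∘ x) → N 𝒞 s x
SeqBall⇒N𝒞 s (pos , eq) = pos , λ n r → bit-injective (eq n r)

-- A sufficient condition for inclusion of the balls. The bound on n loses nothing, by
-- `reaches-bound`, and makes the condition decidable.
SeqRefines : (ℕ → ℕ) → ℕ → ℕ → Set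
SeqRefines val l k = 0 < k ! 1 ×
  (∀ n → n < suc (k ! 2) → Reaches k n → Reaches l n × val ((l ! 0) ! n) ≡ val ((k ! 0) ! n))

-- A decidable formal inclusion of basic neighbourhoods.

Refines : Space → ℕ → ℕ → Set
Refines ω       l k = 0 < k ! 1 × (k ! 1 ≤ suc (k ! 2) → l ! 1 ≤ suc (l ! 2) × l ! 0 ≡ k ! 0)
Refines 𝒩       l k = SeqRefines id l k
Refines 𝒞       l k = SeqRefines sgn l k
Refines (X ⊗ Y) l k = Refines X (l ! 0) (k ! 0) × Refines Y (l ! 1) (k ! 1)

SeqRefinesᴿ : {val : ℕ → ℕ} →
              (∀ {n} {f : Vec ℕ n → ℕ} → Recursive f → Recursive (λ v → val (f v))) →
              Recursive f → Recursive g → Decidableᴿ (λ v → SeqRefines val (f v) (g v))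
SeqRefinesᴿ V F G =
  (constant 0 <ᴿ G !ᴿ constant 1) ∧ᴿ
  ∀<ᴿ (sucᴿ (G !ᴿ constant 2))
    (Reachesᴿ (weakenᴿ G) #0 ⇒ᴿ
     (Reachesᴿ (weakenᴿ F) #0 ∧ᴿ
      (V ((weakenᴿ F !ᴿ constant 0) !ᴿ #0) ≡ᴿ V ((weakenᴿ G !ᴿ constant 0) !ᴿ #0))))

Refinesᴿ : ∀ X → Recursive f → Recursive g → Decidableᴿ (λ v → Refines X (f v) (g v))
Refinesᴿ ω F G =
  (constant 0 <ᴿ G !ᴿ constant 1) ∧ᴿ
  ((G !ᴿ constant 1 ≤ᴿ sucᴿ (G !ᴿ constant 2)) ⇒ᴿ
   ((F !ᴿ constant 1 ≤ᴿ sucᴿ (F !ᴿ constant 2)) ∧ᴿ (F !ᴿ constant 0 ≡ᴿ G !ᴿ constant 0)))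
Refinesᴿ 𝒩       F G = SeqRefinesᴿ {val = id} id F G
Refinesᴿ 𝒞       F G = SeqRefinesᴿ {val = sgn} sgnᴿ F G
Refinesᴿ (X ⊗ Y) F G =
  Refinesᴿ X (F !ᴿ constant 0) (G !ᴿ constant 0) ∧ᴿ Refinesᴿ Y (F !ᴿ constant 1) (G !ᴿ constant 1)

SeqRefines-sound : ∀ {val l k α} → SeqRefines val l k → SeqBall val l α → SeqBall val k α
SeqRefines-sound {k = k} (pos , ref) (_ , eq) =
  pos , λ n r → let r′ , e = ref n (reaches-bound k pos r) r in trans (eq n r′) e

refines-sound : ∀ X l k {x} → Refines X l k → N X l x → N X k x
refines-sound ω l k (pos , ref) (_ , eq) = pos , λ r → let r′ , e = ref r in trans (eq r′) e
refines-sound 𝒩 l k {x} ref p = SeqRefines-sound {id} {l} {k} {x} ref p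
refines-sound 𝒞 l k ref p = SeqBall⇒N𝒞 k (SeqRefines-sound {sgn} {l} {k} ref (N𝒞⇒SeqBall l p))
refines-sound (X ⊗ Y) l k (p , q) (x∈ , y∈) =
  refines-sound X (l ! 0) (k ! 0) p x∈ , refines-sound Y (l ! 1) (k ! 1) q y∈

SeqRefines-trans : ∀ {val m l k} → SeqRefines val m l → SeqRefines val l k → SeqRefines val m k
SeqRefines-trans {l = l} (pos-l , ref-l) (pos-k , ref-k) =
  pos-k , λ n lt r → let r′ , e = ref-k n lt r
                         r″ , e′ = ref-l n (reaches-bound l pos-l r′) r′
                     in r″ , trans e′ e

refines-trans : ∀ X m l k → Refines X m l → Refines X l k → Refines X m k
refines-trans ω m l k (_ , ref-l) (pos-k , ref-k) =
  pos-k , λ r → let r′ , e = ref-k r ; r″ , e′ = ref-l r′ in r″ , trans e′ e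
refines-trans 𝒩 m l k p q = SeqRefines-trans {id} {m} {l} {k} p q
refines-trans 𝒞 m l k p q = SeqRefines-trans {sgn} {m} {l} {k} p q
refines-trans (X ⊗ Y) m l k (p , p′) (q , q′) =
  refines-trans X (m ! 0) (l ! 0) (k ! 0) p q , refines-trans Y (m ! 1) (l ! 1) (k ! 1) p′ q′

-- A ball k of positive radius constrains only places up to `k ! 2`, so the first D + 1 entries of α
-- decide all balls with `k ! 2 ≤ D` at once. The hypothesis on `val` says that the entries of α are
-- admissible values of a centre, for instance bits in the case of 𝒞.
SeqBall-common : ∀ val α → (∀ n → val (α n) ≡ α n) → ∀ D → ∃[ m ] SeqBall val m α ×
  (∀ k → k ! 2 ≤ D → SeqBall val k α → SeqRefines val m k)
SeqBall-common val α val-α D with code-prefix α (suc D)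
... | c , eq = m , (pos , λ n r → trans (sym (val-α n)) (cong val (sym (at (reaches-unit⁻ c D r))))) , ref
  where
  m = ball c 1 D
  pos : 0 < m ! 1
  pos rewrite ball-numerator c 1 D = s≤s z≤n
  at : ∀ {n} → n ≤ D → (m ! 0) ! n ≡ α n
  at {n} le rewrite ball-centre c 1 D = eq (s≤s le)
  ref : ∀ k → k ! 2 ≤ D → SeqBall val k α → SeqRefines val m k
  ref k k≤D (pos-k , eq-k) = pos-k , λ n lt r →
    let n≤D = ≤-trans (s≤s⁻¹ lt) k≤D
    in reaches-unit c D n≤D , trans (cong val (at n≤D)) (trans (val-α n) (eq-k n r))

sgn-bit : ∀ b → sgn (bit b) ≡ bit b
sgn-bit b = cong bit (isPositive-bit b)

single : ℕ → ℕ
single n = ball n 1 0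

singleᴿ : Recursive f → Recursive (λ v → single (f v))
singleᴿ F = ballᴿ F (constant 1) (constant 0)

∈-single : ∀ n → N ω (single n) n
∈-single n rewrite ball-numerator n 1 0 | ball-centre n 1 0 = s≤s z≤n , λ _ → refl

∈-single⁻ : ∀ n {x} → N ω (single n) x → x ≡ n
∈-single⁻ n (_ , eq) rewrite ball-numerator n 1 0 | ball-denominator n 1 0 | ball-centre n 1 0 = eq (s≤s z≤n)

-- This is what makes Σ⁰₁ sets closed under intersection. For sequences, a long enough prefix of the
-- common point is the centre of m.
refines-directed : ∀ X k l {x} → N X k x → N X l x → ∃[ m ] N X m x × Refines X m k × Refines X m l
refines-directed ω k l {x} (pos-k , eq-k) (pos-l , eq-l) =
  single x , ∈-single x , (pos-k , λ r → le , trans (ball-centre x 1 0) (eq-k r)) ,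
                          (pos-l , λ r → le , trans (ball-centre x 1 0) (eq-l r))
  where
  le : single x ! 1 ≤ suc (single x ! 2)
  le rewrite ball-numerator x 1 0 = s≤s z≤n
refines-directed 𝒩 k l {x} p q with SeqBall-common id x (λ _ → refl) (k ! 2 + l ! 2)
... | m , x∈m , ref = m , x∈m , ref k (m≤m+n (k ! 2) (l ! 2)) p , ref l (m≤n+m (l ! 2) (k ! 2)) q
refines-directed 𝒞 k l {x} p q with SeqBall-common sgn (bit ∘ x) (sgn-bit ∘ x) (k ! 2 + l ! 2)
... | m , x∈m , ref = m , SeqBall⇒N𝒞 m x∈m , ref k (m≤m+n (k ! 2) (l ! 2)) (N𝒞⇒SeqBall k p) ,
                      ref l (m≤n+m (l ! 2) (k ! 2)) (N𝒞⇒SeqBall l q)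
refines-directed (X ⊗ Y) k l (p , p′) (q , q′)
  with refines-directed X (k ! 0) (l ! 0) p q | refines-directed Y (k ! 1) (l ! 1) p′ q′
... | m , x∈m , r , s | m′ , y∈m′ , r′ , s′ = m ▸ m′ ▸ 0 , product
  where
  product : N (X ⊗ Y) (m ▸ m′ ▸ 0) _ × Refines (X ⊗ Y) (m ▸ m′ ▸ 0) k × Refines (X ⊗ Y) (m ▸ m′ ▸ 0) l
  product rewrite ▸-zero m (m′ ▸ 0) | ▸-one m m′ 0 = (x∈m , y∈m′) , (r , r′) , (s , s′)

N-covers : ∀ X x → ∃[ m ] N X m x
N-covers ω x = single x , ∈-single x
N-covers 𝒩 x with SeqBall-common id x (λ _ → refl) 0
... | m , x∈m , _ = m , x∈m
N-covers 𝒞 x with SeqBall-common sgn (bit ∘ x) (sgn-bit ∘ x) 0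
... | m , x∈m , _ = m , SeqBall⇒N𝒞 m x∈m
N-covers (X ⊗ Y) (x , y) with N-covers X x | N-covers Y y
... | m , p | m′ , q = m ▸ m′ ▸ 0 , product
  where
  product : N (X ⊗ Y) (m ▸ m′ ▸ 0) (x , y)
  product rewrite ▸-zero m (m′ ▸ 0) | ▸-one m m′ 0 = p , q

refines-directed< : ∀ X {x} b (k : ℕ → ℕ) → (∀ n → n < b → N X (k n) x) →
                    ∃[ m ] N X m x × (∀ n → n < b → Refines X m (k n))
refines-directed< X {x} zero k _ with N-covers X x
... | m , p = m , p , λ _ ()
refines-directed< X (suc b) k p with refines-directed< X b k (λ n lt → p n (m<n⇒m<1+n lt))
... | m , x∈m , ref with refines-directed X m (k b) x∈m (p b ≤-refl)
... | m′ , x∈m′ , r , s = m′ , x∈m′ , λ n lt →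
  [ (λ lt′ → refines-trans X m′ m (k n) r (ref n lt′)) , (λ { refl → s }) ]′ (m<1+n⇒m<n∨m≡n lt)

-- Index 0 is the padding of enumerations, at stages that contribute nothing.
¬N-zero : ∀ X {x} → ¬ N X 0 x
¬N-zero ω (() , _)
¬N-zero 𝒩 (() , _)
¬N-zero 𝒞 (() , _)
¬N-zero (X ⊗ Y) (p , _) = ¬N-zero X p

N-resp : ∀ X s {x x′} → Eq X x x′ → N X s x → N X s x′
N-resp ω s refl p = p
N-resp 𝒩 s eq (pos , p) = pos , λ n r → trans (sym (eq n)) (p n r)
N-resp 𝒞 s eq (pos , p) = pos , λ n r → trans (sym (eq n)) (p n r)
N-resp (X ⊗ Y) s (eq , eq′) (p , q) = N-resp X (s ! 0) eq p , N-resp Y (s ! 1) eq′ q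

Eq-sym : ∀ X {x y} → Eq X x y → Eq X y x
Eq-sym ω       eq = sym eq
Eq-sym 𝒩       eq = λ n → sym (eq n)
Eq-sym 𝒞       eq = λ n → sym (eq n)
Eq-sym (X ⊗ Y) (p , q) = Eq-sym X p , Eq-sym Y q

Nωᴿ : Recursive f → Recursive g → Decidableᴿ (λ v → N ω (f v) (g v))
Nωᴿ F G = (constant 0 <ᴿ F !ᴿ constant 1) ∧ᴿ
          ((F !ᴿ constant 1 ≤ᴿ sucᴿ (F !ᴿ constant 2)) ⇒ᴿ (G ≡ᴿ F !ᴿ constant 0))

∈-product : ∀ X Y k l {x y} → N X k x → N Y l y → N (X ⊗ Y) (k ▸ l ▸ 0) (x , y)
∈-product X Y k l p q rewrite ▸-zero k (l ▸ 0) | ▸-one k l 0 = p , q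

∈-product⁻ : ∀ X Y k l {x y} → N (X ⊗ Y) (k ▸ l ▸ 0) (x , y) → N X k x × N Y l y
∈-product⁻ X Y k l p rewrite ▸-zero k (l ▸ 0) | ▸-one k l 0 = p

unit-ball : ∀ val {α} c q → (∀ {n} → n ≤ q → α n ≡ val (c ! n)) → SeqBall val (ball c 1 q) α
unit-ball val c q eq = subst (0 <_) (sym (ball-numerator c 1 q)) (s≤s z≤n) , λ n r →
  trans (eq (reaches-unit⁻ c q r)) (cong (λ s → val (s ! n)) (sym (ball-centre c 1 q)))

unit-ball⁻ : ∀ val {α} c q → SeqBall val (ball c 1 q) α → ∀ {n} → n ≤ q → α n ≡ val (c ! n)
unit-ball⁻ val c q (_ , eq) {n} le =
  trans (eq n (reaches-unit c q le)) (cong (λ s → val (s ! n)) (ball-centre c 1 q))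

-- Closure properties of lightface Σ⁰₁ sets

private
  variable
    X Y Z : Space

record SigmaOne (X : Space) (P : El X → Set) : Set where
  field
    enum           : ℕ → ℕ
    enum-recursive : Recursive₁ enum
    covered        : ∀ {x} → P x → ∃[ i ] N X (enum i) x
    sound          : ∀ {x} i → N X (enum i) x → P x

open SigmaOne

toΣ⁰₁ : {P : El X → Set} → SigmaOne X P → Σ⁰₁ X P
toΣ⁰₁ p = enum p , ext (λ { (_ ∷ []) → refl }) (Recursive₁.recursive₁ (enum-recursive p)) ,
  covered p , λ (i , q) → sound p i q

fromΣ⁰₁ : {P : El X → Set} → Σ⁰₁ X P → SigmaOne X P
fromΣ⁰₁ (ε , rec , to , from) = record
  { enum           = ε
  ; enum-recursive = mk₁ (ext (λ { (_ ∷ []) → refl }) rec)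
  ; covered        = to
  ; sound          = λ i q → from (i , q)
  }

enumᴿ : {P : El X → Set} {f : Vec ℕ n → ℕ} (p : SigmaOne X P) → Recursive f → Recursive (λ v → enum p (f v))
enumᴿ p = apply₁ (enum-recursive p)

infixr 2 _∧Σ_
infixr 1 _∨Σ_
infixr 4 _,ᴹ_
infixr 9 _∘ᴹ_
infix 4 _≡Σ_ _<Σ_ _≢Σ_

opaque
  -- The common form of the closure proofs below: the tuple v carries the witnesses of all
  -- existential quantifiers, and a decidable condition accepts it or replaces its neighbourhood by
  -- the empty one.
  union-Σ : ∀ {n X} {P : El X → Set} {ε : Vec ℕ n → ℕ} {D : Vec ℕ n → Set} → Recursive ε → Decidableᴿ D →
            (∀ x → P x → ∃[ v ] D v × N X (ε v) x) → (∀ x v → D v → N X (ε v) x → P x) →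
            SigmaOne X P
  union-Σ {n = n} {X = X} {P = P} {ε} {D} E d covers sound-at = record
    { enum           = en
    ; enum-recursive = mk₁ (if0ᴿ (decodeᴿ (recursive d)) (decodeᴿ E) (constant 0))
    ; covered        = λ {x} p → let v , q , r = covers x p in encode v , hit v q r
    ; sound          = sound-enum
    }
    where
    en : ℕ → ℕ
    en i = if0 (char d (decode n i)) (ε (decode n i)) 0
    decodeᴿ : {g : Vec ℕ n → ℕ} → Recursive g → Recursive {1} (λ v → g (decode n (lookup v zero)))
    decodeᴿ G = compose G (λ i → #0 !ᴿ constant (toℕ i))
    hit : ∀ {x} v → D v → N X (ε v) x → N X (en (encode v)) x
    hit v q r rewrite decode-encode v | char≡0 d v q = r
    sound-enum : ∀ {x} i → N X (en i) x → P x
    sound-enum {x} i r with char d (decode n i) in eq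
    ... | zero  = sound-at x (decode n i) (char≡0⁻ d _ eq) r
    ... | suc _ = ⊥-elim (¬N-zero X r)

  resp-Σ : {P Q : El X → Set} → (∀ {x} → P x → Q x) → (∀ {x} → Q x → P x) → SigmaOne X P → SigmaOne X Q
  resp-Σ to from p = record
    { enum           = enum p
    ; enum-recursive = enum-recursive p
    ; covered        = λ q → covered p (from q)
    ; sound          = λ i r → to (sound p i r)
    }

  Σ-extensional : {P : El X → Set} → SigmaOne X P → ∀ {x x′} → Eq X x x′ → P x → P x′
  Σ-extensional {X = X} p eq q = let i , r = covered p q in sound p i (N-resp X (enum p i) eq r)

  _∧Σ_ : ∀ {X} {P Q : El X → Set} → SigmaOne X P → SigmaOne X Q → SigmaOne X (λ x → P x × Q x)
  _∧Σ_ {X = X} p q = union-Σ #0 (Refinesᴿ X #0 (enumᴿ p #1) ∧ᴿ Refinesᴿ X #0 (enumᴿ q #2))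
    (λ x (a , b) → let i , r = covered p a ; j , s = covered q b
                       m , x∈m , u , v = refines-directed X (enum p i) (enum q j) r s
                   in m ∷ i ∷ j ∷ [] , (u , v) , x∈m)
    (λ { x (m ∷ i ∷ j ∷ []) (u , v) x∈m →
         sound p i (refines-sound X m (enum p i) u x∈m) , sound q j (refines-sound X m (enum q j) v x∈m) })

  _∨Σ_ : ∀ {X} {P Q : El X → Set} → SigmaOne X P → SigmaOne X Q → SigmaOne X (λ x → P x ⊎ Q x)
  _∨Σ_ {X = X} {P} {Q} p q = record
    { enum           = en
    ; enum-recursive = mk₁ (if0ᴿ (fstᴿ #0) (enumᴿ p (sndᴿ #0)) (enumᴿ q (sndᴿ #0)))
    ; covered        = [ (λ a → let i , r = covered p a in pair 0 i , left i r)
                       , (λ b → let i , r = covered q b in pair 1 i , right i r) ]′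
    ; sound          = sound-enum
    }
    where
    en : ℕ → ℕ
    en i = if0 (fst i) (enum p (snd i)) (enum q (snd i))
    left : ∀ {x} i → N X (enum p i) x → N X (en (pair 0 i)) x
    left i r rewrite unpair-pair 0 i = r
    right : ∀ {x} i → N X (enum q i) x → N X (en (pair 1 i)) x
    right i r rewrite unpair-pair 1 i = r
    sound-enum : ∀ {x} i → N X (en i) x → P x ⊎ Q x
    sound-enum i r with fst i
    ... | zero  = inj₁ (sound p (snd i) r)
    ... | suc _ = inj₂ (sound q (snd i) r)

  ∃Σ : {P : El (X ⊗ ω) → Set} → SigmaOne (X ⊗ ω) P → SigmaOne X (λ x → ∃[ n ] P (x , n))
  ∃Σ {X = X} p = union-Σ (enumᴿ p #0 !ᴿ constant 0) (Nωᴿ (enumᴿ p #0 !ᴿ constant 1) #1)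
    (λ x (n , a) → let i , (r , s) = covered p a in i ∷ n ∷ [] , s , r)
    (λ { x (i ∷ n ∷ []) s r → n , sound p i (r , s) })

  -- Finitely many neighbourhoods witness the instances below a fixed bound: w codes their indices,
  -- and m refines their projections to X. The bound is itself a coordinate, fixed by the
  -- neighbourhood `single b`.
  ∀<-bound : {P : El (X ⊗ ω) → Set} → SigmaOne (X ⊗ ω) P →
       SigmaOne (X ⊗ ω) (λ p → ∀ n → n < proj₂ p → P (proj₁ p , n))
  ∀<-bound {X = X} {P = P} p = union-Σ
    (#0 ▸ᴿ singleᴿ #1 ▸ᴿ constant 0)
    (∀<ᴿ #1 (Refinesᴿ X #1 (enumᴿ p (#3 !ᴿ #0) !ᴿ constant 0) ∧ᴿ Nωᴿ (enumᴿ p (#3 !ᴿ #0) !ᴿ constant 1) #0))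
    (λ (x , b) a → covers x b a)
    (λ { (x , b) (m ∷ b′ ∷ w ∷ []) d r → sound-at x b m b′ w d (∈-product⁻ X ω m (single b′) r) })
    where
    Near : ℕ → ℕ → ℕ → Set
    Near m b w = ∀ n → n < b → Refines X m (enum p (w ! n) ! 0) × N ω (enum p (w ! n) ! 1) n
    sound-at : ∀ x b m b′ w → Near m b′ w → N X m x × N ω (single b′) b → ∀ n → n < b → P (x , n)
    sound-at x b m b′ w d (x∈m , b∈) n n<b with ∈-single⁻ b′ b∈
    ... | refl = let u , v = d n n<b in
      sound p (w ! n) (refines-sound X m (enum p (w ! n) ! 0) u x∈m , v)
    covers : ∀ x b → (∀ n → n < b → P (x , n)) →
          ∃[ v ] Near (lookup v zero) (lookup v (suc zero)) (lookup v (suc (suc zero))) ×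
                 N (X ⊗ ω) (lookup {n = 3} v zero ▸ single (lookup v (suc zero)) ▸ 0) (x , b)
    covers x b a = glue (proj₁ (code-prefix index b)) λ n lt → wit n lt
      where
      index : ℕ → ℕ
      index n with n <? b
      ... | yes lt = proj₁ (covered p (a n lt))
      ... | no  _  = 0
      index-hit : ∀ n → n < b → N (X ⊗ ω) (enum p (index n)) (x , n)
      index-hit n lt with n <? b
      ... | yes lt′ = proj₂ (covered p (a n lt′))
      ... | no  ¬lt = ⊥-elim (¬lt lt)
      wit : ∀ n → n < b → N (X ⊗ ω) (enum p (proj₁ (code-prefix index b) ! n)) (x , n)
      wit n lt rewrite proj₂ (code-prefix index b) lt = index-hit n lt
      glue : ∀ w → (∀ n → n < b → N (X ⊗ ω) (enum p (w ! n)) (x , n)) →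
             ∃[ v ] Near (lookup v zero) (lookup v (suc zero)) (lookup v (suc (suc zero))) ×
                    N (X ⊗ ω) (lookup {n = 3} v zero ▸ single (lookup v (suc zero)) ▸ 0) (x , b)
      glue w hit =
        let m , x∈m , ref = refines-directed< X b (λ n → enum p (w ! n) ! 0) (λ n lt → proj₁ (hit n lt))
        in m ∷ b ∷ w ∷ [] , (λ n lt → ref n lt , proj₂ (hit n lt)) ,
           ∈-product X ω m (single b) x∈m (∈-single b)

-- Recursive maps

record RecMap (X Y : Space) (h : El X → El Y) : Set where
  constructor recMap
  field graph : SigmaOne (X ⊗ ω) (λ p → N Y (proj₂ p) (h (proj₁ p)))

open RecMap public

opaque
  substΣ : {h : El X → El Y} {P : El Y → Set} → RecMap X Y h → SigmaOne Y P → SigmaOne X (λ x → P (h x))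
  substΣ {X = X} {Y = Y} {h = h} H p = union-Σ (enumᴿ (graph H) #1 !ᴿ constant 0) (Nωᴿ (enumᴿ (graph H) #1 !ᴿ constant 1) (enumᴿ p #0))
    (λ x a → let i , r = covered p a ; j , (u , v) = covered (graph H) {x , enum p i} r in i ∷ j ∷ [] , v , u)
    (λ { x (i ∷ j ∷ []) v u → sound p i (sound (graph H) {x , enum p i} j (u , v)) })

  reindexΣ : {P : El (X ⊗ ω) → Set} {h : ℕ → ℕ} → Recursive₁ h → SigmaOne (X ⊗ ω) P →
             SigmaOne (X ⊗ ω) (λ p → P (proj₁ p , h (proj₂ p)))
  reindexΣ {X = X} {P = P} {h = h} H p = union-Σ
    ((enumᴿ p #0 !ᴿ constant 0) ▸ᴿ singleᴿ #1 ▸ᴿ constant 0)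
    (Nωᴿ (enumᴿ p #0 !ᴿ constant 1) (apply₁ H #1))
    (λ (x , k) a → let i , (u , v) = covered p a in i ∷ k ∷ [] , v , ∈-product X ω _ (single k) u (∈-single k))
    (λ { (x , k) (i ∷ k′ ∷ []) v r → go i k′ v (∈-product⁻ X ω (enum p i ! 0) (single k′) r) })
    where
    go : ∀ {x k} i k′ → N ω (enum p i ! 1) (h k′) → N X (enum p i ! 0) x × N ω (single k′) k → P (x , h k)
    go i k′ v (u , k∈) with ∈-single⁻ k′ k∈
    ... | refl = sound p i (u , v)

  ∘π₁ : {h : El X → El Y} → RecMap X Y h → RecMap (X ⊗ Z) Y (λ p → h (proj₁ p))
  ∘π₁ {X = X} {Y = Y} {Z = Z} {h = h} H = recMap (union-Σ
    (((enumᴿ (graph H) #0 !ᴿ constant 0) ▸ᴿ #1 ▸ᴿ constant 0) ▸ᴿ (enumᴿ (graph H) #0 !ᴿ constant 1) ▸ᴿ constant 0)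
    (constant 0 ≡ᴿ constant 0)
    (λ ((x , z) , k) a → let i , (u , v) = covered (graph H) {x , k} a ; l , z∈ = N-covers Z z in
       i ∷ l ∷ [] , refl , ∈-product (X ⊗ Z) ω (enum (graph H) i ! 0 ▸ l ▸ 0) _ (∈-product X Z (enum (graph H) i ! 0) l u z∈) v)
    (λ { ((x , z) , k) (i ∷ l ∷ []) _ r →
         let r′ , v = ∈-product⁻ (X ⊗ Z) ω (enum (graph H) i ! 0 ▸ l ▸ 0) (enum (graph H) i ! 1) r
             u , _ = ∈-product⁻ X Z (enum (graph H) i ! 0) l r′
         in sound (graph H) i (u , v) }))

  idᴹ : RecMap X X (λ x → x)
  idᴹ {X = X} = recMap (union-Σ (#0 ▸ᴿ singleᴿ #0 ▸ᴿ constant 0) (constant 0 ≡ᴿ constant 0)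
    (λ (x , k) r → k ∷ [] , refl , ∈-product X ω k (single k) r (∈-single k))
    (λ { (x , k) (k′ ∷ []) _ r → go k′ (∈-product⁻ X ω k′ (single k′) r) }))
    where
    go : ∀ {x k} k′ → N X k′ x × N ω (single k′) k → N X k x
    go k′ (u , k∈) with ∈-single⁻ k′ k∈
    ... | refl = u

  π₁ᴹ : RecMap (X ⊗ Y) X proj₁
  π₁ᴹ = ∘π₁ idᴹ

  π₂ᴹ : RecMap (X ⊗ Y) Y proj₂
  π₂ᴹ {X = X} {Y = Y} = recMap (union-Σ ((#0 ▸ᴿ #1 ▸ᴿ constant 0) ▸ᴿ singleᴿ #1 ▸ᴿ constant 0) (constant 0 ≡ᴿ constant 0)
    (λ ((x , y) , k) r → let l , x∈ = N-covers X x in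
       l ∷ k ∷ [] , refl , ∈-product (X ⊗ Y) ω (l ▸ k ▸ 0) (single k) (∈-product X Y l k x∈ r) (∈-single k))
    (λ { ((x , y) , k) (l ∷ k′ ∷ []) _ r → go l k′ (∈-product⁻ (X ⊗ Y) ω (l ▸ k′ ▸ 0) (single k′) r) }))
    where
    go : ∀ {x y k} l k′ → N (X ⊗ Y) (l ▸ k′ ▸ 0) (x , y) × N ω (single k′) k → N Y k y
    go l k′ (u , k∈) with ∈-single⁻ k′ k∈
    ... | refl = proj₂ (∈-product⁻ X Y l k′ u)

  _,ᴹ_ : {h : El X → El Y} {h′ : El X → El Z} → RecMap X Y h → RecMap X Z h′ → RecMap X (Y ⊗ Z) (λ x → h x , h′ x)
  H ,ᴹ H′ = recMap (reindexΣ (mk₁ (#0 !ᴿ constant 0)) (graph H) ∧Σ reindexΣ (mk₁ (#0 !ᴿ constant 1)) (graph H′))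

  _∘ᴹ_ : {h′ : El Y → El Z} {h : El X → El Y} → RecMap Y Z h′ → RecMap X Y h → RecMap X Z (λ x → h′ (h x))
  H′ ∘ᴹ H = recMap (substΣ (∘π₁ H ,ᴹ π₂ᴹ) (graph H′))

  pointᴹ : {y : El Y} → SigmaOne ω (λ k → N Y k y) → RecMap X Y (λ _ → y)
  pointᴹ p = recMap (substΣ π₂ᴹ p)

  recursive₁ᴹ : {h : ℕ → ℕ} → Recursive₁ h → RecMap ω ω h
  recursive₁ᴹ {h} H = recMap (union-Σ (singleᴿ #0 ▸ᴿ singleᴿ #1 ▸ᴿ constant 0) (Nωᴿ #1 (apply₁ H #0))
    (λ (a , k) r → a ∷ k ∷ [] , r , ∈-product ω ω (single a) (single k) (∈-single a) (∈-single k))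
    (λ { (a , k) (a′ ∷ k′ ∷ []) r s → go a′ k′ r (∈-product⁻ ω ω (single a′) (single k′) s) }))
    where
    go : ∀ {a k} a′ k′ → N ω k′ (h a′) → N ω (single a′) a × N ω (single k′) k → N ω k (h a)
    go a′ k′ r (u , v) with ∈-single⁻ a′ u | ∈-single⁻ k′ v
    ... | refl | refl = r

  recursive₂ᴹ : {h : ℕ → ℕ → ℕ} → Recursive₂ h → RecMap (ω ⊗ ω) ω (λ p → h (proj₁ p) (proj₂ p))
  recursive₂ᴹ {h} H = recMap (union-Σ ((singleᴿ #0 ▸ᴿ singleᴿ #1 ▸ᴿ constant 0) ▸ᴿ singleᴿ #2 ▸ᴿ constant 0)
      (Nωᴿ #2 (apply₂ H #0 #1))
    (λ ((a , b) , k) r → a ∷ b ∷ k ∷ [] , r , ∈-product (ω ⊗ ω) ω (single a ▸ single b ▸ 0) (single k)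
       (∈-product ω ω (single a) (single b) (∈-single a) (∈-single b)) (∈-single k))
    (λ { ((a , b) , k) (a′ ∷ b′ ∷ k′ ∷ []) r s →
         let u , v = ∈-product⁻ (ω ⊗ ω) ω (single a′ ▸ single b′ ▸ 0) (single k′) s in
         go a′ b′ k′ r (∈-product⁻ ω ω (single a′) (single b′) u) v }))
    where
    go : ∀ {a b k} a′ b′ k′ → N ω k′ (h a′ b′) → N ω (single a′) a × N ω (single b′) b → N ω (single k′) k → N ω k (h a b)
    go a′ b′ k′ r (u , v) w with ∈-single⁻ a′ u | ∈-single⁻ b′ v | ∈-single⁻ k′ w
    ... | refl | refl | refl = r

  map₁ᴹ : {h : ℕ → ℕ} {a : El X → ℕ} → Recursive₁ h → RecMap X ω a → RecMap X ω (λ x → h (a x))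
  map₁ᴹ H A = recursive₁ᴹ H ∘ᴹ A

  map₂ᴹ : {h : ℕ → ℕ → ℕ} {a b : El X → ℕ} → Recursive₂ h → RecMap X ω a → RecMap X ω b → RecMap X ω (λ x → h (a x) (b x))
  map₂ᴹ H A B = recursive₂ᴹ H ∘ᴹ (A ,ᴹ B)

  infixl 8 _!ᴹ_
  _!ᴹ_ : {a b : El X → ℕ} → RecMap X ω a → RecMap X ω b → RecMap X ω (λ x → a x ! b x)
  _!ᴹ_ = map₂ᴹ !-recursive

  constᴹ : ∀ n → RecMap X ω (λ _ → n)
  constᴹ n = pointᴹ (union-Σ (singleᴿ #0) (Nωᴿ #0 (constant n))
    (λ k r → k ∷ [] , r , ∈-single k)
    (λ { k (k′ ∷ []) r s → subst (λ k → N ω k n) (sym (∈-single⁻ k′ s)) r }))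

  decidableΣ : {D : Vec ℕ 1 → Set} {a : El X → ℕ} → Decidableᴿ D → RecMap X ω a → SigmaOne X (λ x → D (a x ∷ []))
  decidableΣ {D = D} d A = substΣ A (union-Σ (singleᴿ #0) d
    (λ a q → a ∷ [] , q , ∈-single a)
    (λ { a (a′ ∷ []) q r → subst (λ a → D (a ∷ [])) (sym (∈-single⁻ a′ r)) q }))

  decidable₂Σ : {R : ℕ → ℕ → Set} {a b : El X → ℕ} → Decidableᴿ {2} (λ v → R (lookup v zero) (lookup v (suc zero))) →
                RecMap X ω a → RecMap X ω b → SigmaOne X (λ x → R (a x) (b x))
  decidable₂Σ {R = R} d A B = substΣ (A ,ᴹ B) (union-Σ (singleᴿ #0 ▸ᴿ singleᴿ #1 ▸ᴿ constant 0) d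
    (λ (a , b) q → a ∷ b ∷ [] , q , ∈-product ω ω (single a) (single b) (∈-single a) (∈-single b))
    (λ { (a , b) (a′ ∷ b′ ∷ []) q r → go a′ b′ q (∈-product⁻ ω ω (single a′) (single b′) r) }))
    where
    go : ∀ {a b} a′ b′ → R a′ b′ → N ω (single a′) a × N ω (single b′) b → R a b
    go a′ b′ q (u , v) with ∈-single⁻ a′ u | ∈-single⁻ b′ v
    ... | refl | refl = q

  _≡Σ_ : {a b : El X → ℕ} → RecMap X ω a → RecMap X ω b → SigmaOne X (λ x → a x ≡ b x)
  _≡Σ_ = decidable₂Σ {R = _≡_} (#0 ≡ᴿ #1)

  _≢Σ_ : {a b : El X → ℕ} → RecMap X ω a → RecMap X ω b → SigmaOne X (λ x → a x ≢ b x)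
  _≢Σ_ = decidable₂Σ {R = _≢_} (¬ᴿ (#0 ≡ᴿ #1))

  _<Σ_ : {a b : El X → ℕ} → RecMap X ω a → RecMap X ω b → SigmaOne X (λ x → a x < b x)
  _<Σ_ = decidable₂Σ {R = _<_} (#0 <ᴿ #1)

  ∀<Σ : {P : El (X ⊗ ω) → Set} {b : El X → ℕ} → RecMap X ω b → SigmaOne (X ⊗ ω) P →
        SigmaOne X (λ x → ∀ n → n < b x → P (x , n))
  ∀<Σ B p = substΣ (idᴹ ,ᴹ B) (∀<-bound p)

  ∈Σ : {h : El X → El Y} {k : El X → ℕ} → RecMap X Y h → RecMap X ω k → SigmaOne X (λ x → N Y (k x) (h x))
  ∈Σ H K = substΣ (idᴹ ,ᴹ K) (graph H)

  functionᴹ : {h : El X → ℕ} → SigmaOne (X ⊗ ω) (λ p → h (proj₁ p) ≡ proj₂ p) → RecMap X ω h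
  functionᴹ {X = X} {h = h} p = recMap (resp-Σ (λ { {p} (v , eq , r) → subst (N ω (proj₂ p)) (sym eq) r }) (λ r → _ , refl , r)
    (∃Σ (substΣ (π₁ᴹ ∘ᴹ π₁ᴹ ,ᴹ π₂ᴹ) p ∧Σ ∈Σ π₂ᴹ (π₂ᴹ ∘ᴹ π₁ᴹ))))

  -- The ball of radius 1 / (n + 1) around α fixes the entry n, so a prefix c of length n + 1 is
  -- enough to evaluate α at n.
  eval𝒩ᴹ : {h : El X → Baire} {a : El X → ℕ} → RecMap X 𝒩 h → RecMap X ω a → RecMap X ω (λ x → h x (a x))
  eval𝒩ᴹ H A = recMap (union-Σ
      ((ballᴿ #0 (constant 1) #1 ▸ᴿ singleᴿ #1 ▸ᴿ constant 0) ▸ᴿ singleᴿ #2 ▸ᴿ constant 0)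
      (Nωᴿ #2 (#0 !ᴿ #1))
    (λ ((α , n) , k) r → let c , eq = code-prefix α (suc n) in
       c ∷ n ∷ k ∷ [] , subst (N ω k) (sym (eq ≤-refl)) r ,
       ∈-product (𝒩 ⊗ ω) ω (ball c 1 n ▸ single n ▸ 0) (single k)
         (∈-product 𝒩 ω (ball c 1 n) (single n) (unit-ball id c n (λ le → sym (eq (s≤s le)))) (∈-single n)) (∈-single k))
    (λ { ((α , n) , k) (c ∷ n′ ∷ k′ ∷ []) r s →
         let u , w = ∈-product⁻ (𝒩 ⊗ ω) ω (ball c 1 n′ ▸ single n′ ▸ 0) (single k′) s
             u′ , v = ∈-product⁻ 𝒩 ω (ball c 1 n′) (single n′) u
         in go α c n′ k′ r u′ (∈-single⁻ n′ v) (∈-single⁻ k′ w) }))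
    ∘ᴹ (H ,ᴹ A)
    where
    go : ∀ α {n k} c n′ k′ → N ω k′ (c ! n′) → N 𝒩 (ball c 1 n′) α → n ≡ n′ → k ≡ k′ → N ω k (α n)
    go α c n k r p refl refl = subst (N ω k) (sym (unit-ball⁻ id c n p ≤-refl)) r

  eval𝒞ᴹ : {h : El X → El 𝒞} {a : El X → ℕ} → RecMap X 𝒞 h → RecMap X ω a → RecMap X ω (λ x → bit (h x (a x)))
  eval𝒞ᴹ H A = recMap (union-Σ
      ((ballᴿ #0 (constant 1) #1 ▸ᴿ singleᴿ #1 ▸ᴿ constant 0) ▸ᴿ singleᴿ #2 ▸ᴿ constant 0)
      (Nωᴿ #2 (sgnᴿ (#0 !ᴿ #1)))
    (λ ((x , n) , k) r → let c , eq = code-prefix (λ i → bit (x i)) (suc n)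
                             eq′ = λ {i} le → trans (sym (sgn-bit (x i))) (cong sgn (sym (eq {i} (s≤s le)))) in
       c ∷ n ∷ k ∷ [] , subst (N ω k) (eq′ ≤-refl) r ,
       ∈-product (𝒞 ⊗ ω) ω (ball c 1 n ▸ single n ▸ 0) (single k)
         (∈-product 𝒞 ω (ball c 1 n) (single n) (SeqBall⇒N𝒞 (ball c 1 n) (unit-ball sgn c n eq′)) (∈-single n)) (∈-single k))
    (λ { ((x , n) , k) (c ∷ n′ ∷ k′ ∷ []) r s →
         let u , w = ∈-product⁻ (𝒞 ⊗ ω) ω (ball c 1 n′ ▸ single n′ ▸ 0) (single k′) s
             u′ , v = ∈-product⁻ 𝒞 ω (ball c 1 n′) (single n′) u
         in go x c n′ k′ r (N𝒞⇒SeqBall (ball c 1 n′) u′) (∈-single⁻ n′ v) (∈-single⁻ k′ w) }))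
    ∘ᴹ (H ,ᴹ A)
    where
    go : ∀ (x : ℕ → Bool) {n k} c n′ k′ → N ω k′ (sgn (c ! n′)) →
         SeqBall sgn (ball c 1 n′) (λ i → bit (x i)) → n ≡ n′ → k ≡ k′ → N ω k (bit (x n))
    go x c n k r p refl refl = subst (N ω k) (sym (unit-ball⁻ sgn c n p ≤-refl)) r

  SeqBall-bound : ∀ val {α} s → 0 < s ! 1 × (∀ n → n < suc (s ! 2) → Reaches s n → α n ≡ val ((s ! 0) ! n)) →
                  SeqBall val s α
  SeqBall-bound val s (pos , eq) = pos , λ n r → eq n (reaches-bound s pos r) r

  -- Membership in a ball of positive radius is a bounded conjunction of equations between entries.
  -- Hence a map into 𝒩 or 𝒞 is recursive as soon as its entries are, uniformly in the place.
  SeqBallΣ : {val : ℕ → ℕ} {h : El X → Baire} → Recursive₁ val → RecMap (X ⊗ ω) ω (λ p → h (proj₁ p) (proj₂ p)) →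
             SigmaOne (X ⊗ ω) (λ p → SeqBall val (proj₂ p) (h (proj₁ p)))
  SeqBallΣ {X = X} {val = val} {h = h} V H = resp-Σ
    (λ {p} (pos , b) → SeqBall-bound val (proj₂ p) (pos , λ n lt r → [ (λ ¬r → ⊥-elim (¬r r)) , (λ eq → eq) ]′ (b n lt)))
    (λ {p} → expand p)
    (decidableΣ (constant 0 <ᴿ #0 !ᴿ constant 1) π₂ᴹ ∧Σ
     ∀<Σ (map₁ᴹ (mk₁ (sucᴿ (#0 !ᴿ constant 2))) π₂ᴹ)
      (decidable₂Σ {R = λ s n → ¬ Reaches s n} (¬ᴿ (Reachesᴿ #0 #1)) (π₂ᴹ ∘ᴹ π₁ᴹ) π₂ᴹ ∨Σ
       (H ∘ᴹ (π₁ᴹ ∘ᴹ π₁ᴹ ,ᴹ π₂ᴹ) ≡Σ map₂ᴹ {h = λ s n → val ((s ! 0) ! n)} (mk₂ (apply₁ V (#0 !ᴿ constant 0 !ᴿ #1))) (π₂ᴹ ∘ᴹ π₁ᴹ) π₂ᴹ)))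
    where
    expand : ∀ p → SeqBall val (proj₂ p) (h (proj₁ p)) → 0 < proj₂ p ! 1 ×
             (∀ n → n < suc (proj₂ p ! 2) → ¬ Reaches (proj₂ p) n ⊎ h (proj₁ p) n ≡ val ((proj₂ p ! 0) ! n))
    expand (x , s) (pos , eq) = pos , λ n _ → [ (λ r → inj₂ (eq n r)) , inj₁ ]′ (toSum (reaches? s n))

  into𝒩ᴹ : {h : El X → Baire} → RecMap (X ⊗ ω) ω (λ p → h (proj₁ p) (proj₂ p)) → RecMap X 𝒩 h
  into𝒩ᴹ H = recMap (SeqBallΣ {val = id} (mk₁ #0) H)

  into𝒞ᴹ : {h : El X → El 𝒞} → RecMap (X ⊗ ω) ω (λ p → bit (h (proj₁ p) (proj₂ p))) → RecMap X 𝒞 h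
  into𝒞ᴹ {h = h} H = recMap (resp-Σ (λ {p} → SeqBall⇒N𝒞 (proj₂ p)) (λ {p} → N𝒞⇒SeqBall (proj₂ p))
    (SeqBallΣ {val = sgn} {h = λ x n → bit (h x n)} (mk₁ (sgnᴿ #0)) H))

  -- Complements of basic neighbourhoods

  ∉𝒞Σ : SigmaOne (𝒞 ⊗ ω) (λ p → ¬ N 𝒞 (proj₂ p) (proj₁ p))
  ∉𝒞Σ = resp-Σ (λ {p} → from p) (λ {p} → to p)
    (decidableΣ (¬ᴿ (constant 0 <ᴿ #0 !ᴿ constant 1)) π₂ᴹ ∨Σ
     ∃Σ (decidable₂Σ {R = λ s n → Reaches s n} (Reachesᴿ #0 #1) (π₂ᴹ ∘ᴹ π₁ᴹ) π₂ᴹ ∧Σ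
         (eval𝒞ᴹ (π₁ᴹ ∘ᴹ π₁ᴹ) π₂ᴹ ≢Σ
          map₂ᴹ {h = λ s n → sgn ((s ! 0) ! n)} (mk₂ (sgnᴿ (#0 !ᴿ constant 0 !ᴿ #1))) (π₂ᴹ ∘ᴹ π₁ᴹ) π₂ᴹ)))
    where
    Outside : El (𝒞 ⊗ ω) → Set
    Outside (x , s) = ¬ 0 < s ! 1 ⊎ ∃[ n ] Reaches s n × bit (x n) ≢ sgn ((s ! 0) ! n)
    from : ∀ p → Outside p → ¬ N 𝒞 (proj₂ p) (proj₁ p)
    from (x , s) (inj₁ ¬pos)        (pos , _) = ¬pos pos
    from (x , s) (inj₂ (n , r , ≢)) (_ , eq)  = ≢ (cong bit (eq n r))
    to : ∀ p → ¬ N 𝒞 (proj₂ p) (proj₁ p) → Outside p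
    to (x , s) ∉ with 0 <? s ! 1
    ... | no ¬pos = inj₁ ¬pos
    -- Only places up to `s ! 2` are constrained, so a disagreement is found by a finite search;
    -- this is why basic neighbourhoods of 𝒞 are clopen.
    ... | yes pos with search (suc (s ! 2))
      where
      search : ∀ b → (∃[ n ] Reaches s n × bit (x n) ≢ sgn ((s ! 0) ! n)) ⊎
                     (∀ n → n < b → Reaches s n → bit (x n) ≡ sgn ((s ! 0) ! n))
      search zero = inj₂ λ _ ()
      search (suc b) with search b
      ... | inj₁ found = inj₁ found
      ... | inj₂ none with reaches? s b | bit (x b) ≟ sgn ((s ! 0) ! b)
      ... | yes r | no ≢ = inj₁ (b , r , ≢)
      ... | yes r | yes eq = inj₂ λ n lt r′ → [ (λ lt′ → none n lt′ r′) , (λ { refl → eq }) ]′ (m<1+n⇒m<n∨m≡n lt)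
      ... | no ¬r | _ = inj₂ λ n lt r′ → [ (λ lt′ → none n lt′ r′) , (λ { refl → ⊥-elim (¬r r′) }) ]′ (m<1+n⇒m<n∨m≡n lt)
    ... | inj₁ found = inj₂ found
    ... | inj₂ none  = ⊥-elim (∉ (SeqBall⇒N𝒞 s (SeqBall-bound sgn {λ n → bit (x n)} s (pos , none))))

-- The uniform version of Σ⁰₁: it turns a Σ⁰₁ set with a numerical parameter into a recursive family
-- of basic Borel codes.
Enumeration : (El (ω ⊗ X) → Set) → Set
Enumeration {X} P =
  ∃[ β ] Recursive₂ β × (∀ q x → P (q , x) → ∃[ i ] N X (β q i) x) × (∀ q x i → N X (β q i) x → P (q , x))

opaque
  fibre-enum : {P : El (ω ⊗ X) → Set} → SigmaOne (ω ⊗ X) P →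
               Enumeration P
  fibre-enum {X = X} {P = P} p = go (Nωᴿ (enumᴿ p #1 !ᴿ constant 0) #0)
    where
    go : Decidableᴿ {2} (λ v → N ω (enum p (lookup v (suc zero)) ! 0) (lookup v zero)) → Enumeration P
    go D = β , mk₂ (if0ᴿ (ext (λ { (_ ∷ _ ∷ []) → refl }) (recursive D)) (enumᴿ p #1 !ᴿ constant 1) (constant 0)) , to , from
      where
      β : ℕ → ℕ → ℕ
      β q i = if0 (char D (q ∷ i ∷ [])) (enum p i ! 1) 0
      to : ∀ q x → P (q , x) → ∃[ i ] N X (β q i) x
      to q x a = let i , (u , v) = covered p a in i , hit i u v
        where
        hit : ∀ i → N ω (enum p i ! 0) q → N X (enum p i ! 1) x → N X (β q i) x
        hit i u v rewrite char≡0 D (q ∷ i ∷ []) u = v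
      from : ∀ q x i → N X (β q i) x → P (q , x)
      from q x i r with char D (q ∷ i ∷ []) in eq
      ... | zero  = sound p i (char≡0⁻ D (q ∷ i ∷ []) eq , r)
      ... | suc _ = ⊥-elim (¬N-zero X r)

  if0ᴹ : {a b c : El X → ℕ} → RecMap X ω a → RecMap X ω b → RecMap X ω c → RecMap X ω (λ x → if0 (a x) (b x) (c x))
  if0ᴹ {X} {a} {b} {c} A B C = functionᴹ (resp-Σ (λ {p} → forth p) (λ {p} → back p)
    (((A ∘ᴹ π₁ᴹ ≡Σ constᴹ 0) ∧Σ (B ∘ᴹ π₁ᴹ ≡Σ π₂ᴹ)) ∨Σ ((A ∘ᴹ π₁ᴹ ≢Σ constᴹ 0) ∧Σ (C ∘ᴹ π₁ᴹ ≡Σ π₂ᴹ))))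
    where
    Case : El (X ⊗ ω) → Set
    Case (x , v) = (a x ≡ 0 × b x ≡ v) ⊎ (a x ≢ 0 × c x ≡ v)
    forth : ∀ p → Case p → if0 (a (proj₁ p)) (b (proj₁ p)) (c (proj₁ p)) ≡ proj₂ p
    forth (x , v) q with a x
    forth (x , v) (inj₁ (_ , e))  | zero  = e
    forth (x , v) (inj₂ (nz , e)) | zero  = ⊥-elim (nz refl)
    forth (x , v) (inj₂ (_ , e))  | suc _ = e
    back : ∀ p → if0 (a (proj₁ p)) (b (proj₁ p)) (c (proj₁ p)) ≡ proj₂ p → Case p
    back (x , v) e with a x
    ... | zero  = inj₁ (refl , e)
    ... | suc _ = inj₂ ((λ ()) , e)

  ∉ωΣ : SigmaOne (ω ⊗ ω) (λ p → ¬ N ω (proj₂ p) (proj₁ p))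
  ∉ωΣ = decidable₂Σ {R = λ a k → ¬ N ω k a} (¬ᴿ (Nωᴿ #1 #0)) π₁ᴹ π₂ᴹ

  -- Pairs that fail D give the default 0, which has to be harmless wherever θ is used.
  image-enum : {D : ℕ → ℕ → Set} → Decidableᴿ {2} (λ v → D (lookup v zero) (lookup v (suc zero))) →
               ∃[ θ ] Recursive₁ θ × (∀ i q → D i q → ∃[ t ] θ t ≡ q) × (∀ t → θ t ≡ 0 ⊎ (∃[ i ] D i (θ t)))
  image-enum {D} d = θ ,
    mk₁ (if0ᴿ {c = λ v → char d (fst (lookup v zero) ∷ snd (lookup v zero) ∷ [])}
              (ext (λ _ → refl) (compose {fs = args} (recursive d) λ { zero → fstᴿ #0 ; (suc zero) → sndᴿ #0 }))
              (sndᴿ #0) (constant 0)) ,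
    (λ i q p → pair i q , hit i q p) , values
    where
    args : Fin 2 → Vec ℕ 1 → ℕ
    args zero    v = fst (lookup v zero)
    args (suc _) v = snd (lookup v zero)
    θ : ℕ → ℕ
    θ t = if0 (char d (fst t ∷ snd t ∷ [])) (snd t) 0
    hit : ∀ i q → D i q → θ (pair i q) ≡ q
    hit i q p rewrite unpair-pair i q | char≡0 d (i ∷ q ∷ []) p = refl
    values : ∀ t → θ t ≡ 0 ⊎ (∃[ i ] D i (θ t))
    values t with char d (fst t ∷ snd t ∷ []) in eq
    ... | zero  = inj₂ (fst t , char≡0⁻ d (fst t ∷ snd t ∷ []) eq)
    ... | suc _ = inj₁ refl

open Equivalence using (to; from)

-- Indices and the recursion theorem

module Parametrized (𝒢 : GoodParametrization) where
  open GoodParametrization 𝒢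

  GΣ : ∀ X → SigmaOne (𝒩 ⊗ X) (G X)
  GΣ X = fromΣ⁰₁ (G-Σ⁰₁ X)

  opaque
    index : ∀ {X} {P : El X → Set} → SigmaOne X P →
            ∃[ γ ] SigmaOne ω (λ k → N 𝒩 k γ) × (∀ x → P x ⇔ G X (γ , x))
    index {X} {P} p with to (G-recursive X P) (toΣ⁰₁ p)
    ... | γ , rec , eq = γ , fromΣ⁰₁ rec , λ x → mk⇔ (proj₁ eq) (proj₂ eq)

  Sᴹ : ∀ X Y → RecMap (𝒩 ⊗ X) 𝒩 (S X Y)
  Sᴹ X Y = recMap (fromΣ⁰₁ (S-recursive X Y))

  valueΣ : ∀ {X Y h} → RecMap X Y h → ∀ x → SigmaOne ω (λ k → N X k x) → SigmaOne ω (λ k → N Y k (h x))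
  valueΣ H x p = ∈Σ (H ∘ᴹ pointᴹ p) idᴹ

  opaque
    -- Kleene's diagonal argument: if ε is an index of the set of all (α , x) with Q (S (α , α) ,
    -- x), then e = S (ε , ε) is an index of the section of Q at e.
    recursion-theorem : ∀ {X} {Q : El (𝒩 ⊗ X) → Set} → SigmaOne (𝒩 ⊗ X) Q →
                        ∃[ e ] SigmaOne ω (λ k → N 𝒩 k e) × (∀ x → Q (e , x) ⇔ G X (e , x))
    recursion-theorem {X} {Q} q
      with index (substΣ (Sᴹ 𝒩 X ∘ᴹ (π₁ᴹ ,ᴹ π₁ᴹ) ,ᴹ π₂ᴹ) q)
    ... | ε , ε-rec , eq = S 𝒩 X (ε , ε) , valueΣ (Sᴹ 𝒩 X ∘ᴹ (idᴹ ,ᴹ idᴹ)) ε ε-rec ,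
      λ x → mk⇔ (λ a → to (S-section 𝒩 X ε ε x) (to (eq (ε , x)) a))
                (λ a → from (eq (ε , x)) (from (S-section 𝒩 X ε ε x) a))

  -- Substituting a partial recursive function into a Σ⁰₁ set: A (w , k) says that its value at w lies in N 𝒩 k.
  Partial : ∀ {W Z} {P : El (𝒩 ⊗ Z) → Set} → SigmaOne (𝒩 ⊗ Z) P → (El (W ⊗ ω) → Set) → El (W ⊗ Z) → Set
  Partial {Z = Z} p A (w , z) = ∃[ i ] A (w , enum p i ! 0) × N Z (enum p i ! 1) z

  PartialΣ : ∀ {W Z} {P : El (𝒩 ⊗ Z) → Set} {A} (p : SigmaOne (𝒩 ⊗ Z) P) → SigmaOne (W ⊗ ω) A →
             SigmaOne (W ⊗ Z) (Partial {W} p A)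
  PartialΣ p a = ∃Σ (substΣ (π₁ᴹ ∘ᴹ π₁ᴹ ,ᴹ (map₁ᴹ (enum-recursive p) π₂ᴹ !ᴹ constᴹ 0)) a ∧Σ
                     ∈Σ (π₂ᴹ ∘ᴹ π₁ᴹ) (map₁ᴹ (enum-recursive p) π₂ᴹ !ᴹ constᴹ 1))

  -- P is a union of neighbourhoods, so its truth at y is witnessed by one neighbourhood of y, which
  -- A recognizes. Totality is required only at the w in question, which lets `Unfold` be defined
  -- for every e.
  Partial-value : ∀ {W Z} {P : El (𝒩 ⊗ Z) → Set} {A} (p : SigmaOne (𝒩 ⊗ Z) P) {w} y →
                  (∀ k → N 𝒩 k y ⇔ A (w , k)) → ∀ z → Partial {W} p A (w , z) ⇔ P (y , z)
  Partial-value p y val z = mk⇔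
    (λ (i , u , v) → sound p i (from (val _) u , v))
    (λ a → let i , (u , v) = covered p a in i , to (val _) u , v)

-- The completed tree of a Borel code

module BorelTree (em : ExcludedMiddle 0ℓ) (𝒢 : GoodParametrization) (Λ : CountableWellOrder) where
  open GoodParametrization 𝒢
  open CountableWellOrder Λ
  open Borel 𝒢 Λ
  open Parametrized 𝒢

  double-negation : ∀ {P : Set} → ¬ ¬ P → P
  double-negation {P} = decidable-stable (em {P = P})

  record Node : Set where
    constructor ⟨_⟩
    field
      {code} : Baire
      {rank} : Carrier
      bc     : BC rank code

  open Node public

  opaque
    ∉-family : Enumeration {𝒞} (λ (k , x) → ¬ N 𝒞 k x)
    ∉-family = fibre-enum (substΣ (π₂ᴹ ,ᴹ π₁ᴹ) ∉𝒞Σ)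

  -- A basic code of the complement of `N 𝒞 k`: the first entry 0 marks it as basic, and the
  -- neighbourhoods follow.
  co : ℕ → Baire
  co k n = if0 n 0 (proj₁ ∉-family k (pred n))

  codesᴹ : ∀ {β} → Recursive₂ β → RecMap ω 𝒩 (λ k n → if0 n 0 (β k (pred n)))
  codesᴹ B = into𝒩ᴹ (map₂ᴹ (mk₂ (if0ᴿ #1 (constant 0) (apply₂ B #0 (apply₁ pred-recursive #1)))) π₁ᴹ π₂ᴹ)

  coᴹ : RecMap ω 𝒩 co
  coᴹ = codesᴹ (proj₁ (proj₂ ∉-family))

  ⋆ᴹ : RecMap 𝒩 𝒩 _⋆
  ⋆ᴹ = into𝒩ᴹ (eval𝒩ᴹ π₁ᴹ (map₁ᴹ suc-recursive π₂ᴹ))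

  ρ-resp : ∀ X {ξ γ} (c : BC ξ γ) {x x′} → Eq X x x′ → ρ X c x → ρ X c x′
  ρ-resp X {γ = γ} (basic _ _ _) eq (i , p) = i , N-resp X ((γ ⋆) i) eq p
  ρ-resp X (union _ _ _ _ _ _ c) eq (i , p) = i , λ q → p (ρ-resp X (c i) (Eq-sym X eq) q)

  -- Numbering of the nodes below the root of a code: pair 0 i is the i-th child of the root, and chd m j is
  -- the j-th child of m.
  chd : ℕ → ℕ → ℕ
  chd m j = pair (suc m) j

  -- `one` is the level of basic codes, and `top` lists the children of the root γ.
  module Tree
    (one : Carrier) (1≼one : 1≼ one) (¬2≼one : ¬ 2≼ one)
    (γ : Baire) (γ-recursive : SigmaOne ω (λ k → N 𝒩 k γ))
    (top : ℕ → Node) (top-value : ∀ i → Apply ω 𝒩 (γ ⋆) i (code (top i)))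
    where

    -- A basic node has the complements of the basic neighbourhoods it enumerates as children, so that
    -- the set of every node is the union of the complements of the sets of its children.
    child : Node → ℕ → Node
    child ν@(⟨ basic _ _ _ ⟩)  j = ⟨ basic {one} {co (code ν (suc j))} 1≼one ¬2≼one refl ⟩
    child ⟨ union _ _ _ _ _ _ c ⟩ j = ⟨ c j ⟩

    build : (ℕ → Node) → ℕ × ℕ → Node
    build r (zero  , i) = top i
    build r (suc m , j) = child (r m) j

    -- The parent of n has a smaller number by `fst≤`, though not structurally, so the recursion
    -- runs on fuel. Any fuel above n is enough, and the value `top 0` for exhausted fuel does not
    -- enter `node`.
    nodeWithin : ℕ → ℕ → Node
    nodeWithin zero    n = top 0
    nodeWithin (suc f) n = build (nodeWithin f) (unpair n)

    node : ℕ → Node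
    node n = nodeWithin (suc n) n

    build-cong : ∀ {r r′} n → (∀ m → m < n → r m ≡ r′ m) → build r (unpair n) ≡ build r′ (unpair n)
    build-cong n eq with unpair n | fst≤ n
    ... | zero  , i | _  = refl
    ... | suc m , j | le = cong (λ ν → child ν j) (eq m le)

    nodeWithin-stable : ∀ f f′ n → n < f → n < f′ → nodeWithin f n ≡ nodeWithin f′ n
    nodeWithin-stable (suc f) (suc f′) n (s≤s lt) (s≤s lt′) =
      build-cong n λ m m<n → nodeWithin-stable f f′ m (<-≤-trans m<n lt) (<-≤-trans m<n lt′)

    node-build : ∀ n → node n ≡ build node (unpair n)
    node-build n = build-cong n λ m m<n → nodeWithin-stable n (suc m) m m<n ≤-refl

    node-top : ∀ i → node (pair 0 i) ≡ top i
    node-top i = trans (node-build (pair 0 i)) (cong (build node) (unpair-pair 0 i))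

    node-chd : ∀ m j → node (chd m j) ≡ child (node m) j
    node-chd m j = trans (node-build (chd m j)) (cong (build node) (unpair-pair (suc m) j))

    Δ : ℕ → Baire
    Δ n = code (node n)

    set : Node → El 𝒞 → Set
    set ν = ρ 𝒞 (bc ν)

    R : ℕ → El 𝒞 → Set
    R n = set (node n)

    R-resp : ∀ n {x x′} → x ≗ x′ → R n x → R n x′
    R-resp n = ρ-resp 𝒞 (bc (node n))

    co-spec : ∀ k x → (∃[ i ] N 𝒞 (co k (suc i)) x) ⇔ (¬ N 𝒞 k x)
    co-spec k x = mk⇔ (λ (i , p) → proj₂ (proj₂ (proj₂ ∉-family)) k x i p) (proj₁ (proj₂ (proj₂ ∉-family)) k x)

    set-child : ∀ ν x → set ν x ⇔ (∃[ j ] ¬ set (child ν j) x)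
    set-child ν@(⟨ basic _ _ _ ⟩) x = mk⇔
      (λ (j , p) → j , λ q → to (co-spec (code ν (suc j)) x) q p)
      (λ (j , ¬q) → j , double-negation λ ¬p → ¬q (from (co-spec (code ν (suc j)) x) ¬p))
    set-child ⟨ union _ _ _ _ _ _ c ⟩ x = mk⇔ id id

    R-chd : ∀ n x → R n x ⇔ (∃[ j ] ¬ R (chd n j) x)
    R-chd n x = mk⇔
      (λ r → let j , ¬q = to (set-child (node n) x) r in j , λ q → ¬q (subst (λ ν → set ν x) (node-chd n j) q))
      (λ (j , ¬q) → from (set-child (node n) x) (j , λ q → ¬q (subst (λ ν → set ν x) (sym (node-chd n j)) q)))

    -- The computation of child j from the parent's code β, as a Σ⁰₁ condition on the neighbourhoods
    -- k of the child's code. It consults β alone, because ranks and the proofs in a node are not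
    -- computable data.
    ChildCode : El (𝒩 ⊗ (ω ⊗ ω)) → Set
    ChildCode (β , j , k) = (β 0 ≡ 1 × G (ω ⊗ ω) ((β ⋆) , j , k)) ⊎ (β 0 ≡ 0 × N 𝒩 k (co (β (suc j))))

    opaque
      ChildCodeΣ : SigmaOne (𝒩 ⊗ (ω ⊗ ω)) ChildCode
      ChildCodeΣ =
        ((eval𝒩ᴹ π₁ᴹ (constᴹ 0) ≡Σ constᴹ 1) ∧Σ substΣ (⋆ᴹ ∘ᴹ π₁ᴹ ,ᴹ π₂ᴹ) (GΣ (ω ⊗ ω))) ∨Σ
        ((eval𝒩ᴹ π₁ᴹ (constᴹ 0) ≡Σ constᴹ 0) ∧Σ
         ∈Σ (coᴹ ∘ᴹ eval𝒩ᴹ π₁ᴹ (map₁ᴹ suc-recursive (π₁ᴹ ∘ᴹ π₂ᴹ))) (π₂ᴹ ∘ᴹ π₂ᴹ))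

    child-code : ∀ ν j k → ChildCode (code ν , j , k) ⇔ N 𝒩 k (code (child ν j))
    child-code ⟨ basic _ _ 0≡ ⟩ j k = mk⇔
      [ (λ (1≡ , _) → ⊥-elim (0≢1+n (trans (sym 0≡) 1≡))) , proj₂ ]′ (λ p → inj₂ (0≡ , p))
    child-code ⟨ union _ 1≡ _ _ app _ _ ⟩ j k = mk⇔
      [ (λ (_ , g) → from (app j k) g) , (λ (0≡ , _) → ⊥-elim (0≢1+n (trans (sym 0≡) 1≡))) ]′
      (λ p → inj₁ (1≡ , to (app j k) p))

    -- Here e is a proposed index of `Δ`: a top code is computed from γ, any other from the value of
    -- {e} at the parent. An arbitrary e may have no value there, hence `Partial`.
    Unfold : El (𝒩 ⊗ (ω ⊗ ω)) → Set
    Unfold (e , n , k) =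
      (fst n ≡ 0 × G (ω ⊗ ω) ((γ ⋆) , snd n , k)) ⊎
      (fst n ≢ 0 × Partial {𝒩 ⊗ ω} ChildCodeΣ (λ ((e , m) , k) → G (ω ⊗ ω) (e , m , k)) ((e , pred (fst n)) , snd n , k))

    opaque
      UnfoldΣ : SigmaOne (𝒩 ⊗ (ω ⊗ ω)) Unfold
      UnfoldΣ =
        ((fstᴹ ≡Σ constᴹ 0) ∧Σ substΣ (⋆ᴹ ∘ᴹ pointᴹ γ-recursive ,ᴹ sndᴹ ,ᴹ π₂ᴹ ∘ᴹ π₂ᴹ) (GΣ (ω ⊗ ω))) ∨Σ
        ((fstᴹ ≢Σ constᴹ 0) ∧Σ
         substΣ {Y = (𝒩 ⊗ ω) ⊗ (ω ⊗ ω)} ((π₁ᴹ ,ᴹ map₁ᴹ pred-recursive fstᴹ) ,ᴹ sndᴹ ,ᴹ π₂ᴹ ∘ᴹ π₂ᴹ)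
           (PartialΣ {W = 𝒩 ⊗ ω} {A = λ ((e , m) , k) → G (ω ⊗ ω) (e , m , k)} ChildCodeΣ
             (substΣ (π₁ᴹ ∘ᴹ π₁ᴹ ,ᴹ π₂ᴹ ∘ᴹ π₁ᴹ ,ᴹ π₂ᴹ) (GΣ (ω ⊗ ω)))))
        where
        fstᴹ : RecMap (𝒩 ⊗ (ω ⊗ ω)) ω (λ p → fst (proj₁ (proj₂ p)))
        fstᴹ = map₁ᴹ fst-recursive (π₁ᴹ ∘ᴹ π₂ᴹ)
        sndᴹ : RecMap (𝒩 ⊗ (ω ⊗ ω)) ω (λ p → snd (proj₁ (proj₂ p)))
        sndᴹ = map₁ᴹ snd-recursive (π₁ᴹ ∘ᴹ π₂ᴹ)

    -- At a fixed point e of `Unfold`, induction on node numbers shows that {e} is total and equal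
    -- to `Δ`.
    Δᴹ : RecMap ω 𝒩 Δ
    Δᴹ = recMap (resp-Σ (λ {p} → from (value (proj₁ p) (proj₂ p))) (λ {p} → to (value (proj₁ p) (proj₂ p)))
            (substΣ (pointᴹ e-recursive ,ᴹ idᴹ) (GΣ (ω ⊗ ω))))
      where
      e = proj₁ (recursion-theorem UnfoldΣ)
      e-recursive = proj₁ (proj₂ (recursion-theorem UnfoldΣ))
      fix = proj₂ (proj₂ (recursion-theorem UnfoldΣ))
      unfold : ∀ n → (∀ m → m < n → ∀ k → N 𝒩 k (Δ m) ⇔ G (ω ⊗ ω) (e , m , k)) → ∀ k →
               N 𝒩 k (code (build node (unpair n))) ⇔ Unfold (e , n , k)
      unfold n ih k with unpair n | fst≤ n
      ... | zero  , i | _  = mk⇔ (λ p → inj₁ (refl , to (top-value i k) p))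
                                 [ (λ (_ , g) → from (top-value i k) g) , (λ (≢0 , _) → ⊥-elim (≢0 refl)) ]′
      ... | suc m , j | le = mk⇔ (λ p → inj₂ ((λ ()) , from (partial (j , k)) (from (child-code (node m) j k) p)))
                                 [ (λ ()) , (λ (_ , g) → to (child-code (node m) j k) (to (partial (j , k)) g)) ]′
        where
        partial = Partial-value {𝒩 ⊗ ω} {A = λ ((e , m) , k) → G (ω ⊗ ω) (e , m , k)} ChildCodeΣ {e , m} (Δ m) (ih m le)
      value : ∀ n k → N 𝒩 k (Δ n) ⇔ G (ω ⊗ ω) (e , n , k)
      value = <-rec _ λ n ih k →
        let ih′ = λ m m<n → ih {m} m<n in
        mk⇔ (λ p → to (fix (n , k)) (to (unfold n ih′ k) (subst (λ ν → N 𝒩 k (code ν)) (node-build n) p)))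
            (λ g → subst (λ ν → N 𝒩 k (code ν)) (sym (node-build n)) (from (unfold n ih′ k) (from (fix (n , k)) g)))

    -- Labels and the closed set of labellings

    least : ∀ {P : ℕ → Set} → ∃ P → ∃[ j ] P j × (∀ j′ → j′ < j → ¬ P j′)
    least {P} (j , p) with search j
      where
      search : ∀ b → (∃[ j ] P j × (∀ j′ → j′ < j → ¬ P j′)) ⊎ (∀ j → j < b → ¬ P j)
      search zero = inj₂ λ _ ()
      search (suc b) with search b
      ... | inj₁ found = inj₁ found
      ... | inj₂ none with em {P = P b}
      ... | yes p = inj₁ (b , p , none)
      ... | no ¬p = inj₂ λ j lt → [ none j , (λ { refl → ¬p }) ]′ (m<1+n⇒m<n∨m≡n lt)
    ... | inj₁ found = found
    ... | inj₂ none  = j , p , none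

    -- The label of n at x is 0 if x is not in the set of n; otherwise it is j + 1 for the first child j
    -- whose set omits x.
    Label : El 𝒞 → ℕ → ℕ → Set
    Label x n v = (v ≡ 0 × ¬ R n x) ⊎ (∃[ j ] v ≡ suc j × ¬ R (chd n j) x × (∀ j′ → j′ < j → R (chd n j′) x))

    Label-functional : ∀ {x n v v′} → Label x n v → Label x n v′ → v ≡ v′
    Label-functional (inj₁ (refl , _)) (inj₁ (refl , _)) = refl
    Label-functional {x} {n} (inj₁ (_ , ¬r)) (inj₂ (j , _ , ¬q , _)) = ⊥-elim (¬r (from (R-chd n x) (j , ¬q)))
    Label-functional {x} {n} (inj₂ (j , _ , ¬q , _)) (inj₁ (_ , ¬r)) = ⊥-elim (¬r (from (R-chd n x) (j , ¬q)))
    Label-functional (inj₂ (j , refl , ¬q , below)) (inj₂ (j′ , refl , ¬q′ , below′)) with <-cmp j j′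
    ... | tri< lt _ _ = ⊥-elim (¬q (below′ j lt))
    ... | tri≈ _ eq _ = cong suc eq
    ... | tri> _ _ gt = ⊥-elim (¬q′ (below j′ gt))

    Label-total : ∀ x n → ∃[ v ] Label x n v
    Label-total x n with em {P = R n x}
    ... | no ¬r = 0 , inj₁ (refl , ¬r)
    ... | yes r with least (to (R-chd n x) r)
    ... | j , ¬q , below = suc j , inj₂ (j , refl , ¬q , λ j′ lt → double-negation (below j′ lt))

    Label-resp : ∀ {x x′ n v} → x ≗ x′ → Label x n v → Label x′ n v
    Label-resp {n = n} eq (inj₁ (z , ¬r)) = inj₁ (z , λ r → ¬r (R-resp n (λ i → sym (eq i)) r))
    Label-resp {n = n} eq (inj₂ (j , e , ¬q , below)) =
      inj₂ (j , e , (λ q → ¬q (R-resp (chd n j) (λ i → sym (eq i)) q)) , λ j′ lt → R-resp (chd n j′) eq (below j′ lt))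

    label : El 𝒞 → ℕ → ℕ
    label x n = proj₁ (Label-total x n)

    label-unique : ∀ {x n v} → Label x n v → label x n ≡ v
    label-unique {x} {n} = Label-functional (proj₂ (Label-total x n))

    encodeLabels : El 𝒞 → Baire
    encodeLabels x n = pair (bit (x n)) (label x n)

    decodePoint : Baire → El 𝒞
    decodePoint α n = isPositive (fst (α n))

    decodePointᴹ : RecMap 𝒩 𝒞 decodePoint
    decodePointᴹ = into𝒞ᴹ (map₁ᴹ {h = sgn} (mk₁ (sgnᴿ #0)) (map₁ᴹ fst-recursive (eval𝒩ᴹ π₁ᴹ π₂ᴹ)))

    decode-encodeLabels : ∀ x → decodePoint (encodeLabels x) ≗ x
    decode-encodeLabels x n = trans (cong isPositive (fst-pair (bit (x n)) (label x n))) (isPositive-bit (x n))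

    labelOf : Baire → ℕ → ℕ
    labelOf α n = snd (α n)

    -- bad-omission and bad-witness tie the labels of basic nodes to the decoded point. The other conditions only
    -- relate labels to each other, and by induction on codes they then force all labels.
    data Bad (α : Baire) (n : ℕ) : Set where
      bad-bit       : 1 < fst (α n) → Bad α n
      bad-top       : labelOf α (pair 0 n) ≡ 0 → Bad α n
      bad-zero      : labelOf α n ≡ 0 → ∀ j → labelOf α (chd n j) ≡ 0 → Bad α n
      bad-child     : ∀ j → labelOf α n ≡ suc j → labelOf α (chd n j) ≢ 0 → Bad α n
      bad-least     : ∀ j → labelOf α n ≡ suc j → ∀ j′ → j′ < j → labelOf α (chd n j′) ≡ 0 → Bad α n
      bad-omission  : Δ n 0 ≡ 0 → labelOf α n ≡ 0 → ∀ j → N 𝒞 (Δ n (suc j)) (decodePoint α) → Bad α n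
      bad-witness   : Δ n 0 ≡ 0 → ∀ j → labelOf α n ≡ suc j → ¬ N 𝒞 (Δ n (suc j)) (decodePoint α) → Bad α n

    opaque
      BadΣ : SigmaOne 𝒩 (λ α → ∃[ n ] Bad α n)
      BadΣ = ∃Σ (resp-Σ
        [ bad-bit , [ bad-top , [ (λ (e , j , e′) → bad-zero e j e′) , [ (λ (j , e , e′) → bad-child j e e′) ,
          [ (λ (j , e , j′ , lt , e′) → bad-least j e j′ lt e′) ,
          [ (λ (b , e , j , p) → bad-omission b e j p) , (λ (b , j , e , p) → bad-witness b j e p) ]′ ]′ ]′ ]′ ]′ ]′
        (λ { (bad-bit lt) → inj₁ lt
           ; (bad-top e) → inj₂ (inj₁ e)
           ; (bad-zero e j e′) → inj₂ (inj₂ (inj₁ (e , j , e′)))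
           ; (bad-child j e e′) → inj₂ (inj₂ (inj₂ (inj₁ (j , e , e′))))
           ; (bad-least j e j′ lt e′) → inj₂ (inj₂ (inj₂ (inj₂ (inj₁ (j , e , j′ , lt , e′)))))
           ; (bad-omission b e j p) → inj₂ (inj₂ (inj₂ (inj₂ (inj₂ (inj₁ (b , e , j , p))))))
           ; (bad-witness b j e p) → inj₂ (inj₂ (inj₂ (inj₂ (inj₂ (inj₂ (b , j , e , p)))))) })
        ((constᴹ 1 <Σ map₁ᴹ fst-recursive (eval𝒩ᴹ π₁ᴹ π₂ᴹ)) ∨Σ
         (labelᴹ π₁ᴹ (map₂ᴹ pair-recursive (constᴹ 0) π₂ᴹ) ≡Σ constᴹ 0) ∨Σ
         ((labelᴹ π₁ᴹ π₂ᴹ ≡Σ constᴹ 0) ∧Σ ∃Σ (labelᴹ (π₁ᴹ ∘ᴹ π₁ᴹ) (chdᴹ (π₂ᴹ ∘ᴹ π₁ᴹ) π₂ᴹ) ≡Σ constᴹ 0)) ∨Σ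
         ∃Σ (isSuc ∧Σ (labelᴹ (π₁ᴹ ∘ᴹ π₁ᴹ) (chdᴹ (π₂ᴹ ∘ᴹ π₁ᴹ) π₂ᴹ) ≢Σ constᴹ 0)) ∨Σ
         ∃Σ (isSuc ∧Σ ∃Σ ((π₂ᴹ <Σ π₂ᴹ ∘ᴹ π₁ᴹ) ∧Σ
             (labelᴹ (π₁ᴹ ∘ᴹ π₁ᴹ ∘ᴹ π₁ᴹ) (chdᴹ (π₂ᴹ ∘ᴹ π₁ᴹ ∘ᴹ π₁ᴹ) π₂ᴹ) ≡Σ constᴹ 0))) ∨Σ
         (isBasic ∧Σ (labelᴹ π₁ᴹ π₂ᴹ ≡Σ constᴹ 0) ∧Σ ∃Σ (∈Σ (decodePointᴹ ∘ᴹ π₁ᴹ ∘ᴹ π₁ᴹ) entry)) ∨Σ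
         (isBasic ∧Σ ∃Σ (isSuc ∧Σ substΣ (decodePointᴹ ∘ᴹ π₁ᴹ ∘ᴹ π₁ᴹ ,ᴹ entry) ∉𝒞Σ))))
        where
        labelᴹ : ∀ {X} {h : El X → Baire} {a : El X → ℕ} → RecMap X 𝒩 h → RecMap X ω a →
                 RecMap X ω (λ x → labelOf (h x) (a x))
        labelᴹ H A = map₁ᴹ snd-recursive (eval𝒩ᴹ H A)
        chdᴹ : ∀ {X} {a b : El X → ℕ} → RecMap X ω a → RecMap X ω b → RecMap X ω (λ x → chd (a x) (b x))
        chdᴹ A B = map₂ᴹ pair-recursive (map₁ᴹ suc-recursive A) B
        isSuc : SigmaOne ((𝒩 ⊗ ω) ⊗ ω) (λ p → labelOf (proj₁ (proj₁ p)) (proj₂ (proj₁ p)) ≡ suc (proj₂ p))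
        isSuc = labelᴹ (π₁ᴹ ∘ᴹ π₁ᴹ) (π₂ᴹ ∘ᴹ π₁ᴹ) ≡Σ map₁ᴹ suc-recursive π₂ᴹ
        isBasic : SigmaOne (𝒩 ⊗ ω) (λ p → Δ (proj₂ p) 0 ≡ 0)
        isBasic = eval𝒩ᴹ (Δᴹ ∘ᴹ π₂ᴹ) (constᴹ 0) ≡Σ constᴹ 0
        entry : RecMap ((𝒩 ⊗ ω) ⊗ ω) ω (λ p → Δ (proj₂ (proj₁ p)) (suc (proj₂ p)))
        entry = eval𝒩ᴹ (Δᴹ ∘ᴹ π₂ᴹ ∘ᴹ π₁ᴹ) (map₁ᴹ suc-recursive π₂ᴹ)

    Labelling : Baire → Set
    Labelling α = ¬ (∃[ n ] Bad α n)

    zero-or-suc : ∀ v → v ≡ 0 ⊎ (∃[ j ] v ≡ suc j)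
    zero-or-suc zero    = inj₁ refl
    zero-or-suc (suc j) = inj₂ (j , refl)

    module _ {α : Baire} (good : Labelling α) where

      -- Both claims are proved together because complements exchange them: a label 0 forces nonzero
      -- labels on all children, which then contain the point, and a label j + 1 forces the label 0
      -- on child j, which then omits it. The induction stops at basic codes, whose labels are
      -- compared with the point directly.
      labelling-truth : ∀ {η δ} (c : BC η δ) n → node n ≡ ⟨ c ⟩ →
                        (labelOf α n ≡ 0 → ¬ ρ 𝒞 c (decodePoint α)) ×
                        (∀ j → labelOf α n ≡ suc j → ρ 𝒞 c (decodePoint α))
      labelling-truth {δ = δ} (basic _ _ δ0≡0) n eq =
        (λ e (j , p) → good (n , bad-omission Δ0≡0 e j (subst (λ β → N 𝒞 (β (suc j)) (decodePoint α)) (sym Δ≡) p))) ,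
        (λ j e → j , double-negation λ ¬p →
          good (n , bad-witness Δ0≡0 j e (λ p → ¬p (subst (λ β → N 𝒞 (β (suc j)) (decodePoint α)) Δ≡ p))))
        where
        Δ≡ : Δ n ≡ δ
        Δ≡ = cong code eq
        Δ0≡0 : Δ n 0 ≡ 0
        Δ0≡0 = trans (cong (λ β → β 0) Δ≡) δ0≡0
      labelling-truth (union _ _ _ _ _ _ c) n eq =
        (λ e (j , ¬p) → [ (λ z → good (n , bad-zero e j z)) , (λ (i , s) → ¬p (proj₂ (below j) i s)) ]′
                          (zero-or-suc (labelOf α (chd n j)))) ,
        (λ j e → j , [ proj₁ (below j) , (λ (i , s) → ⊥-elim (good (n , bad-child j e λ z → 0≢1+n (trans (sym z) s)))) ]′
                       (zero-or-suc (labelOf α (chd n j))))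
        where
        below : ∀ j → _
        below j = labelling-truth (c j) (chd n j) (trans (node-chd n j) (cong (λ ν → child ν j) eq))

      label-zero : ∀ n → labelOf α n ≡ 0 → ¬ R n (decodePoint α)
      label-zero n = proj₁ (labelling-truth (bc (node n)) n refl)

      label-suc : ∀ n j → labelOf α n ≡ suc j → R n (decodePoint α)
      label-suc n = proj₂ (labelling-truth (bc (node n)) n refl)

      labelling-Label : ∀ n → Label (decodePoint α) n (labelOf α n)
      labelling-Label n with zero-or-suc (labelOf α n)
      ... | inj₁ e = inj₁ (e , label-zero n e)
      ... | inj₂ (j , e) = inj₂ (j , e , omitted , earlier)
        where
        omitted : ¬ R (chd n j) (decodePoint α)
        omitted with zero-or-suc (labelOf α (chd n j))
        ... | inj₁ z = label-zero (chd n j) z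
        ... | inj₂ (i , s) = ⊥-elim (good (n , bad-child j e λ z → 0≢1+n (trans (sym z) s)))
        earlier : ∀ j′ → j′ < j → R (chd n j′) (decodePoint α)
        earlier j′ lt with zero-or-suc (labelOf α (chd n j′))
        ... | inj₁ z = ⊥-elim (good (n , bad-least j e j′ lt z))
        ... | inj₂ (i , s) = label-suc (chd n j′) i s

      -- The labels are determined by the point by `Label-functional`; `bad-bit` excludes first
      -- components above 1, which would decode to the same bit as 1. This yields both the
      -- injectivity of f and the fact that g inverts it.
      labelling-unique : ∀ {y} → decodePoint α ≗ y → encodeLabels y ≗ α
      labelling-unique {y} eq n =
        trans (cong₂ pair (bit-eq (fst (α n)) refl) (label-unique (Label-resp {n = n} eq (labelling-Label n))))
                                        (pair-unpair (α n))
        where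
        bit-eq : ∀ b → fst (α n) ≡ b → bit (y n) ≡ b
        bit-eq zero          e = cong bit (trans (sym (eq n)) (cong isPositive e))
        bit-eq (suc zero)    e = cong bit (trans (sym (eq n)) (cong isPositive e))
        bit-eq (suc (suc b)) e = ⊥-elim (good (n , bad-bit (subst (1 <_) (sym e) (s≤s (s≤s z≤n)))))

      labelling-top : ∀ i → R (pair 0 i) (decodePoint α)
      labelling-top i with zero-or-suc (labelOf α (pair 0 i))
      ... | inj₁ z = ⊥-elim (good (i , bad-top z))
      ... | inj₂ (j , s) = label-suc (pair 0 i) j s

    basic-R : ∀ n x → Δ n 0 ≡ 0 → R n x ⇔ (∃[ j ] N 𝒞 (Δ n (suc j)) x)
    basic-R n x z with node n
    ... | ⟨ basic _ _ _ ⟩ = mk⇔ id id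
    ... | ⟨ union _ 1≡ _ _ _ _ _ ⟩ = ⊥-elim (0≢1+n (trans (sym z) 1≡))

    basic-R-chd : ∀ n j x → Δ n 0 ≡ 0 → R (chd n j) x ⇔ (¬ N 𝒞 (Δ n (suc j)) x)
    basic-R-chd n j x z = mk⇔
      (λ q → to (of-child (node n) z) (subst (λ ν → set ν x) (node-chd n j) q))
      (λ p → subst (λ ν → set ν x) (sym (node-chd n j)) (from (of-child (node n) z) p))
      where
      of-child : ∀ ν → code ν 0 ≡ 0 → set (child ν j) x ⇔ (¬ N 𝒞 (code ν (suc j)) x)
      of-child ν@(⟨ basic _ _ _ ⟩) z = co-spec (code ν (suc j)) x
      of-child ⟨ union _ 1≡ _ _ _ _ _ ⟩ z = ⊥-elim (0≢1+n (trans (sym z) 1≡))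

    encode-labelling : ∀ x → (∀ i → R (pair 0 i) x) → Labelling (encodeLabels x)
    encode-labelling x tops (n , bad) = contradict bad
      where
      isLabel : ∀ m → Label x m (labelOf (encodeLabels x) m)
      isLabel m = subst (Label x m) (sym (snd-pair (bit (x m)) (label x m))) (proj₂ (Label-total x m))
      zero⇒∉ : ∀ {m} → labelOf (encodeLabels x) m ≡ 0 → ¬ R m x
      zero⇒∉ {m} z with isLabel m
      ... | inj₁ (_ , ¬r) = ¬r
      ... | inj₂ (j , s , _) = ⊥-elim (0≢1+n (trans (sym z) s))
      suc⇒∈ : ∀ {m j} → labelOf (encodeLabels x) m ≡ suc j → ¬ R (chd m j) x × (∀ j′ → j′ < j → R (chd m j′) x)
      suc⇒∈ {m} s with isLabel m
      ... | inj₁ (z , _) = ⊥-elim (0≢1+n (trans (sym z) s))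
      ... | inj₂ (j , s′ , q) with suc-injective (trans (sym s) s′)
      ... | refl = q
      nonzero⇒∈ : ∀ {m} → labelOf (encodeLabels x) m ≢ 0 → R m x
      nonzero⇒∈ {m} nz with isLabel m
      ... | inj₁ (z , _) = ⊥-elim (nz z)
      ... | inj₂ (j , _ , ¬q , _) = from (R-chd m x) (j , ¬q)
      back : ∀ {s} → N 𝒞 s (decodePoint (encodeLabels x)) → N 𝒞 s x
      back {s} = N-resp 𝒞 s (decode-encodeLabels x)
      forth : ∀ {s} → N 𝒞 s x → N 𝒞 s (decodePoint (encodeLabels x))
      forth {s} = N-resp 𝒞 s (λ i → sym (decode-encodeLabels x i))
      contradict : ¬ Bad (encodeLabels x) n
      contradict (bad-bit lt) = bit≤1 (x n) (subst (1 <_) (fst-pair (bit (x n)) (label x n)) lt)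
        where
        bit≤1 : ∀ b → ¬ 1 < bit b
        bit≤1 false ()
        bit≤1 true (s≤s ())
      contradict (bad-top z) = zero⇒∉ {pair 0 n} z (tops n)
      contradict (bad-zero z j z′) = zero⇒∉ {n} z (from (R-chd n x) (j , zero⇒∉ {chd n j} z′))
      contradict (bad-child j s nz) = proj₁ (suc⇒∈ {n} s) (nonzero⇒∈ {chd n j} nz)
      contradict (bad-least j s j′ lt z) = zero⇒∉ {chd n j′} z (proj₂ (suc⇒∈ {n} s) j′ lt)
      contradict (bad-omission b z j p) = zero⇒∉ {n} z (from (basic-R n x b) (j , back {Δ n (suc j)} p))
      contradict (bad-witness b j s ¬p) = proj₁ (suc⇒∈ {n} s) (from (basic-R-chd n j x b) λ p → ¬p (forth {Δ n (suc j)} p))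

    -- Labels computed from memberships below the top level

    -- The nodes below the top level are exactly the nodes nd n.
    nd : ℕ → ℕ
    nd n = chd (fst n) (snd n)

    nd-pair : ∀ m j → nd (pair m j) ≡ chd m j
    nd-pair m j = cong₂ (λ a b → pair (suc a) b) (fst-pair m j) (snd-pair m j)

    nd-pred : ∀ n → fst n ≢ 0 → nd (pair (pred (fst n)) (snd n)) ≡ n
    nd-pred n nz = trans (nd-pair (pred (fst n)) (snd n))
      (trans (cong (λ m → pair m (snd n)) (suc-pred (fst n) {{≢-nonZero nz}})) (pair-unpair n))

    truth : Set → Bool
    truth P = does (em {P = P})

    truth-true : ∀ {P} → P → bit (truth P) ≡ 1
    truth-true {P} p with em {P = P}
    ... | yes _ = refl
    ... | no ¬p = ⊥-elim (¬p p)

    truth-false : ∀ {P} → ¬ P → bit (truth P) ≡ 0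
    truth-false {P} ¬p with em {P = P}
    ... | yes p = ⊥-elim (¬p p)
    ... | no _  = refl

    truth-true⁻ : ∀ {P} → bit (truth P) ≡ 1 → P
    truth-true⁻ {P} eq with em {P = P}
    ... | yes p = p

    truth-false⁻ : ∀ {P} → bit (truth P) ≡ 0 → ¬ P
    truth-false⁻ {P} eq with em {P = P}
    ... | no ¬p = ¬p

    -- With all memberships packed into one point of 𝒞, a Σ⁰₁ condition on this point consults only
    -- a neighbourhood of it, that is, finitely many memberships.
    membership : El 𝒞 → El 𝒞
    membership x n = truth (R (nd n) x)

    -- The label at a point of all top sets, computed from the memberships below the top level only; at the
    -- top level the label 0 cannot occur.
    BitLabel : El 𝒞 → ℕ → ℕ → Set
    BitLabel b n v = (v ≡ 0 × fst n ≢ 0 × bit (b (pair (pred (fst n)) (snd n))) ≡ 0) ⊎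
                     (∃[ j ] v ≡ suc j × bit (b (pair n j)) ≡ 0 × (∀ j′ → j′ < j → bit (b (pair n j′)) ≡ 1))

    BitLabel-Label : ∀ {x} → (∀ i → R (pair 0 i) x) → ∀ n v → BitLabel (membership x) n v ⇔ Label x n v
    BitLabel-Label {x} tops n v = mk⇔ forth back
      where
      forth : BitLabel (membership x) n v → Label x n v
      forth (inj₁ (z , nz , e)) = inj₁ (z , λ r → truth-false⁻ e (subst (λ m → R m x) (sym (nd-pred n nz)) r))
      forth (inj₂ (j , s , e , below)) = inj₂ (j , s ,
        (λ q → truth-false⁻ e (subst (λ m → R m x) (sym (nd-pair n j)) q)) ,
        λ j′ lt → subst (λ m → R m x) (nd-pair n j′) (truth-true⁻ (below j′ lt)))
      back : Label x n v → BitLabel (membership x) n v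
      back (inj₁ (z , ¬r)) = inj₁ (z , nz , truth-false λ r → ¬r (subst (λ m → R m x) (nd-pred n nz) r))
        where
        nz : fst n ≢ 0
        nz e = ¬r (subst (λ m → R m x) (trans (cong (λ m → pair m (snd n)) (sym e)) (pair-unpair n)) (tops (snd n)))
      back (inj₂ (j , s , ¬q , below)) = inj₂ (j , s ,
        truth-false (λ q → ¬q (subst (λ m → R m x) (nd-pair n j) q)) ,
        λ j′ lt → truth-true (subst (λ m → R m x) (sym (nd-pair n j′)) (below j′ lt)))

    Entry : El (((𝒞 ⊗ 𝒞) ⊗ ω) ⊗ ω) → Set
    Entry (((x , b) , n) , a) = fst a ≡ bit (x n) × BitLabel b n (snd a)

    -- The condition that the encoded sequence lies in `N 𝒩 k`, for an arbitrary b in place of the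
    -- memberships. In this form it is jointly Σ⁰₁ in x, k and b; the complexity of g enters only
    -- when b becomes `membership x`.
    Reads : El ((𝒞 ⊗ ω) ⊗ 𝒞) → Set
    Reads ((x , k) , b) = 0 < k ! 1 × (∀ n → n < suc (k ! 2) → ¬ Reaches k n ⊎ Entry (((x , b) , n) , (k ! 0) ! n))

    opaque
      EntryΣ : SigmaOne (((𝒞 ⊗ 𝒞) ⊗ ω) ⊗ ω) Entry
      EntryΣ =
        (map₁ᴹ fst-recursive π₂ᴹ ≡Σ eval𝒞ᴹ (π₁ᴹ ∘ᴹ π₁ᴹ ∘ᴹ π₁ᴹ) (π₂ᴹ ∘ᴹ π₁ᴹ)) ∧Σ
        (((map₁ᴹ snd-recursive π₂ᴹ ≡Σ constᴹ 0) ∧Σ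
          (map₁ᴹ fst-recursive (π₂ᴹ ∘ᴹ π₁ᴹ) ≢Σ constᴹ 0) ∧Σ
          (eval𝒞ᴹ (π₂ᴹ ∘ᴹ π₁ᴹ ∘ᴹ π₁ᴹ) (map₂ᴹ pair-recursive (map₁ᴹ pred-recursive (map₁ᴹ fst-recursive (π₂ᴹ ∘ᴹ π₁ᴹ)))
                                                         (map₁ᴹ snd-recursive (π₂ᴹ ∘ᴹ π₁ᴹ))) ≡Σ constᴹ 0)) ∨Σ
         ∃Σ ((map₁ᴹ snd-recursive (π₂ᴹ ∘ᴹ π₁ᴹ) ≡Σ map₁ᴹ suc-recursive π₂ᴹ) ∧Σ
             (eval𝒞ᴹ (π₂ᴹ ∘ᴹ π₁ᴹ ∘ᴹ π₁ᴹ ∘ᴹ π₁ᴹ) (map₂ᴹ pair-recursive (π₂ᴹ ∘ᴹ π₁ᴹ ∘ᴹ π₁ᴹ) π₂ᴹ) ≡Σ constᴹ 0) ∧Σ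
             ∀<Σ π₂ᴹ (eval𝒞ᴹ (π₂ᴹ ∘ᴹ π₁ᴹ ∘ᴹ π₁ᴹ ∘ᴹ π₁ᴹ ∘ᴹ π₁ᴹ)
                             (map₂ᴹ pair-recursive (π₂ᴹ ∘ᴹ π₁ᴹ ∘ᴹ π₁ᴹ ∘ᴹ π₁ᴹ) π₂ᴹ) ≡Σ constᴹ 1)))

      ReadsΣ : SigmaOne ((𝒞 ⊗ ω) ⊗ 𝒞) Reads
      ReadsΣ =
        (constᴹ 0 <Σ (π₂ᴹ ∘ᴹ π₁ᴹ !ᴹ constᴹ 1)) ∧Σ
        ∀<Σ (map₁ᴹ suc-recursive (π₂ᴹ ∘ᴹ π₁ᴹ !ᴹ constᴹ 2))
          (decidable₂Σ {R = λ s n → ¬ Reaches s n} (¬ᴿ (Reachesᴿ #0 #1)) (π₂ᴹ ∘ᴹ π₁ᴹ ∘ᴹ π₁ᴹ) π₂ᴹ ∨Σ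
           substΣ (((π₁ᴹ ∘ᴹ π₁ᴹ ∘ᴹ π₁ᴹ ,ᴹ π₂ᴹ ∘ᴹ π₁ᴹ) ,ᴹ π₂ᴹ) ,ᴹ ((π₂ᴹ ∘ᴹ π₁ᴹ ∘ᴹ π₁ᴹ !ᴹ constᴹ 0) !ᴹ π₂ᴹ)) EntryΣ)

    Entry-encode : ∀ {x} → (∀ i → R (pair 0 i) x) → ∀ n a →
                   Entry (((x , membership x) , n) , a) ⇔ encodeLabels x n ≡ a
    Entry-encode {x} tops n a = mk⇔
      (λ (e , l) → trans (cong₂ pair (sym e) (label-unique (to (BitLabel-Label tops n (snd a)) l))) (pair-unpair a))
      (λ { refl → fst-pair (bit (x n)) (label x n) ,
                  subst (BitLabel (membership x) n) (sym (snd-pair (bit (x n)) (label x n)))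
                        (from (BitLabel-Label tops n (label x n)) (proj₂ (Label-total x n))) })

    Reads-encode : ∀ {x} → (∀ i → R (pair 0 i) x) → ∀ k →
                   N 𝒩 k (encodeLabels x) ⇔ Reads ((x , k) , membership x)
    Reads-encode {x} tops k = mk⇔
      (λ (pos , eq) → pos , λ n _ → [ (λ r → inj₂ (from (Entry-encode tops n _) (eq n r))) , inj₁ ]′ (toSum (em {P = Reaches k n})))
      (λ (pos , rd) → SeqBall-bound id k (pos , λ n lt r →
        [ (λ ¬r → ⊥-elim (¬r r)) , (λ e → to (Entry-encode tops n _) e) ]′ (rd n lt)))

    numberΣ : ∀ n → SigmaOne ω (λ k → N ω k n)
    numberΣ n = ∈Σ (constᴹ n) idᴹ

    basic-Σ⁰ : ∀ {ξ X} {P : El X → Set} → 1≼ ξ → ¬ 2≼ ξ → SigmaOne X P → Σ⁰ ξ X P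
    basic-Σ⁰ 1≼ξ ¬2≼ξ p =
      (λ n → if0 n 0 (enum p (pred n))) ,
      toΣ⁰₁ (valueΣ (codesᴹ {β = λ _ i → enum p i} (mk₂ (enumᴿ p #1))) 0 (numberΣ 0)) ,
      basic 1≼ξ ¬2≼ξ refl , covered p , λ (i , q) → sound p i q

    module AllBasic (all-basic : ∀ n → Δ n 0 ≡ 0) where

      -- Every `nd n` is now a child of a basic node, so its set is the complement of one basic
      -- neighbourhood, and these are clopen.
      membershipᴹ : RecMap 𝒞 𝒞 membership
      membershipᴹ = into𝒞ᴹ (functionᴹ (resp-Σ (λ {p} → forth p) (λ {p} → back p)
        (((π₂ᴹ ≡Σ constᴹ 0) ∧Σ ∈Σ (π₁ᴹ ∘ᴹ π₁ᴹ) entry) ∨Σ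
         ((π₂ᴹ ≡Σ constᴹ 1) ∧Σ substΣ (π₁ᴹ ∘ᴹ π₁ᴹ ,ᴹ entry) ∉𝒞Σ))))
        where
        entry : RecMap ((𝒞 ⊗ ω) ⊗ ω) ω (λ p → Δ (fst (proj₂ (proj₁ p))) (suc (snd (proj₂ (proj₁ p)))))
        entry = eval𝒩ᴹ (Δᴹ ∘ᴹ map₁ᴹ fst-recursive (π₂ᴹ ∘ᴹ π₁ᴹ)) (map₁ᴹ suc-recursive (map₁ᴹ snd-recursive (π₂ᴹ ∘ᴹ π₁ᴹ)))
        Bit : El ((𝒞 ⊗ ω) ⊗ ω) → Set
        Bit ((x , n) , v) = (v ≡ 0 × N 𝒞 (Δ (fst n) (suc (snd n))) x) ⊎ (v ≡ 1 × ¬ N 𝒞 (Δ (fst n) (suc (snd n))) x)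
        forth : ∀ p → Bit p → bit (membership (proj₁ (proj₁ p)) (proj₂ (proj₁ p))) ≡ proj₂ p
        forth ((x , n) , v) (inj₁ (refl , p)) = truth-false λ r → to (basic-R-chd (fst n) (snd n) x (all-basic (fst n))) r p
        forth ((x , n) , v) (inj₂ (refl , ¬p)) = truth-true (from (basic-R-chd (fst n) (snd n) x (all-basic (fst n))) ¬p)
        back : ∀ p → bit (membership (proj₁ (proj₁ p)) (proj₂ (proj₁ p))) ≡ proj₂ p → Bit p
        back ((x , n) , v) eq with em {P = N 𝒞 (Δ (fst n) (suc (snd n))) x}
        ... | yes p = inj₁ (trans (sym eq) (forth ((x , n) , 0) (inj₁ (refl , p))) , p)
        ... | no ¬p = inj₂ (trans (sym eq) (forth ((x , n) , 1) (inj₂ (refl , ¬p))) , ¬p)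

      readable : SigmaOne (𝒞 ⊗ ω) (λ z → Reads (z , membership (proj₁ z)))
      readable = substΣ (idᴹ ,ᴹ membershipᴹ ∘ᴹ π₁ᴹ) ReadsΣ

    -- Codes of finite unions of node sets

    𝒞ω : Space
    𝒞ω = 𝒞 ⊗ ω

    opaque
      ∉𝒞ω-family : Enumeration {𝒞ω} (λ (k , z) → ¬ N 𝒞ω k z)
      ∉𝒞ω-family = fibre-enum (resp-Σ
        (λ {p} → [ (λ ¬u w → ¬u (proj₁ w)) , (λ ¬v w → ¬v (proj₂ w)) ]′) (λ {p} → split p)
        (substΣ (π₁ᴹ ∘ᴹ π₂ᴹ ,ᴹ (π₁ᴹ !ᴹ constᴹ 0)) ∉𝒞Σ ∨Σ substΣ (π₂ᴹ ∘ᴹ π₂ᴹ ,ᴹ (π₁ᴹ !ᴹ constᴹ 1)) ∉ωΣ))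
        where
        split : ∀ (p : El (ω ⊗ 𝒞ω)) → ¬ N 𝒞ω (proj₁ p) (proj₂ p) →
                ¬ N 𝒞 (proj₁ p ! 0) (proj₁ (proj₂ p)) ⊎ ¬ N ω (proj₁ p ! 1) (proj₂ (proj₂ p))
        split (k , x , m) ¬w with em {P = N 𝒞 (k ! 0) x}
        ... | yes u = inj₂ λ v → ¬w (u , v)
        ... | no ¬u = inj₁ ¬u

    -- q codes a neighbourhood q ! 0 of 𝒞 × ω and the first q ! 2 entries of q ! 1, which are indices of nodes.
    -- UnionOf q is the union of the complement of the former with the cylinders over the sets of the latter.
    listed : ℕ → ℕ → ℕ
    listed q m = nd (q ! 1 ! m)

    UnionOf : ℕ → El 𝒞ω → Set
    UnionOf q z = ¬ N 𝒞ω (q ! 0) z ⊎ (∃[ m ] m < q ! 2 × R (listed q m) (proj₁ z))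

    listedᴹ : ∀ {X} {a b : El X → ℕ} → RecMap X ω a → RecMap X ω b → RecMap X ω (λ x → listed (a x) (b x))
    listedᴹ A B = map₁ᴹ {h = nd} (mk₁ (pairᴿ (sucᴿ (fstᴿ #0)) (sndᴿ #0))) ((A !ᴹ constᴹ 1) !ᴹ B)

    -- Both factors have radius 2, more than any distance. This is the whole space, whose complement
    -- contributes nothing to a union.
    full : ℕ
    full = ball 0 2 0 ▸ ball 0 2 0 ▸ 0

    N-full : ∀ z → N 𝒞ω full z
    N-full (x , m) = ∈-product 𝒞 ω (ball 0 2 0) (ball 0 2 0) (pos , λ n r → ⊥-elim (out n r)) (pos , λ r → ⊥-elim (out′ r))
      where
      pos : 0 < ball 0 2 0 ! 1
      pos rewrite ball-numerator 0 2 0 = s≤s z≤n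
      out : ∀ n → ¬ Reaches (ball 0 2 0) n
      out n r rewrite ball-numerator 0 2 0 | ball-denominator 0 2 0 with r
      ... | s≤s le = 1+n≰n (≤-trans (≤-trans (s≤s z≤n) (m≤n+m (suc (n + 0)) n)) le)
      out′ : ¬ ball 0 2 0 ! 1 ≤ suc (ball 0 2 0 ! 2)
      out′ r rewrite ball-numerator 0 2 0 | ball-denominator 0 2 0 with r
      ... | s≤s ()

    outside : ℕ → ℕ
    outside s = s ▸ 0

    singleton : ℕ → ℕ
    singleton n = full ▸ (n ▸ 0) ▸ 1 ▸ 0

    -- The neighbourhood 0 is empty, so the union is everything. This makes 0 a safe padding: the
    -- complement of everything adds nothing.
    UnionOf-zero : ∀ z → UnionOf 0 z
    UnionOf-zero z = inj₁ (¬N-zero 𝒞ω)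

    outside-length : ∀ s → outside s ! 2 ≡ 0
    outside-length s = ▸-suc s 0 1

    UnionOf-outside : ∀ s z → UnionOf (outside s) z ⇔ (¬ N 𝒞ω s z)
    UnionOf-outside s z = mk⇔
      [ (λ ¬p → subst (λ t → ¬ N 𝒞ω t z) (▸-zero s 0) ¬p)
      , (λ (m , lt , _) → ⊥-elim (m<n⇒n≢0 lt (outside-length s))) ]′
      (λ ¬p → inj₁ (subst (λ t → ¬ N 𝒞ω t z) (sym (▸-zero s 0)) ¬p))

    singleton-listed : ∀ n → listed (singleton n) 0 ≡ nd n
    singleton-listed n = cong nd (trans (cong (λ s → s ! 0) (▸-one full (n ▸ 0) (1 ▸ 0))) (▸-zero n 0))

    singleton-length : ∀ n → singleton n ! 2 ≡ 1
    singleton-length n = ▸-two full (n ▸ 0) 1 0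

    UnionOf-singleton : ∀ n z → UnionOf (singleton n) z ⇔ R (nd n) (proj₁ z)
    UnionOf-singleton n z = mk⇔
      [ (λ ¬p → ⊥-elim (¬p (subst (λ t → N 𝒞ω t z) (sym (▸-zero full _)) (N-full z))))
      , (λ (m , lt , r) → first m (subst (m <_) (singleton-length n) lt) r) ]′
      (λ r → inj₂ (0 , subst (0 <_) (sym (singleton-length n)) (s≤s z≤n) ,
                   subst (λ k → R k (proj₁ z)) (sym (singleton-listed n)) r))
      where
      first : ∀ m → m < 1 → R (listed (singleton n) m) (proj₁ z) → R (nd n) (proj₁ z)
      first zero _ r = subst (λ k → R k (proj₁ z)) (singleton-listed n) r
      first (suc m) (s≤s ()) r

    -- The children of the union q. First component 0 of i runs through neighbourhoods that cover
    -- the complement of `q ! 0`; first component m + 1 runs through the children of the m-th listed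
    -- node. The subtraction tests m < `q ! 2`. Each part lists at most one node.
    part : ℕ → ℕ → ℕ
    part q i = if0 (fst i) (outside (proj₁ ∉𝒞ω-family (q ! 0) (snd i)))
                   (if0 (fst i ∸ q ! 2) (singleton (pair (listed q (pred (fst i))) (snd i))) 0)

    part-recursive : Recursive₂ part
    part-recursive = mk₂ (if0ᴿ (fstᴿ #1)
      (apply₂ (proj₁ (proj₂ ∉𝒞ω-family)) (#0 !ᴿ constant 0) (sndᴿ #1) ▸ᴿ constant 0)
      (if0ᴿ (fstᴿ #1 ∸ᴿ #0 !ᴿ constant 2)
        (constant full ▸ᴿ (pairᴿ (pairᴿ (sucᴿ (fstᴿ entry)) (sndᴿ entry)) (sndᴿ #1) ▸ᴿ constant 0) ▸ᴿ constant 1 ▸ᴿ constant 0)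
        (constant 0)))
      where
      entry : Recursive {2} (λ v → lookup v zero ! 1 ! pred (fst (lookup v (suc zero))))
      entry = #0 !ᴿ constant 1 !ᴿ apply₁ pred-recursive (fstᴿ #1)

    data Part (q i : ℕ) : Set where
      part-outside : part q i ≡ outside (proj₁ ∉𝒞ω-family (q ! 0) (snd i)) → Part q i
      part-child   : ∀ m → m < q ! 2 → part q i ≡ singleton (pair (listed q m) (snd i)) → Part q i
      part-padding : part q i ≡ 0 → Part q i

    part-view : ∀ q i → Part q i
    part-view q i = view (fst i) refl
      where
      partAt : ℕ → ℕ
      partAt a = if0 a (outside (proj₁ ∉𝒞ω-family (q ! 0) (snd i)))
                       (if0 (a ∸ q ! 2) (singleton (pair (listed q (pred a)) (snd i))) 0)
      nonzero : ∀ a {b} → 0 < a → if0 a b 0 ≡ 0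
      nonzero (suc a) _ = refl
      view : ∀ a → fst i ≡ a → Part q i
      view zero e = part-outside (cong partAt e)
      view (suc m) e with m <? q ! 2
      ... | yes lt = part-child m lt (trans (cong partAt e)
              (cong (λ a → if0 a (singleton (pair (listed q m) (snd i))) 0) (m≤n⇒m∸n≡0 lt)))
      ... | no ¬lt = part-padding (trans (cong partAt e) (nonzero (suc m ∸ q ! 2) (m<n⇒0<n∸m (≰⇒> ¬lt))))

    part-pair-zero : ∀ q j → part q (pair 0 j) ≡ outside (proj₁ ∉𝒞ω-family (q ! 0) j)
    part-pair-zero q j rewrite unpair-pair 0 j = refl

    part-pair-suc : ∀ q m j → m < q ! 2 → part q (pair (suc m) j) ≡ singleton (pair (listed q m) j)
    part-pair-suc q m j lt rewrite unpair-pair (suc m) j | m≤n⇒m∸n≡0 lt = refl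

    UnionOf-parts : ∀ q z → UnionOf q z ⇔ (∃[ i ] ¬ UnionOf (part q i) z)
    UnionOf-parts q z = mk⇔ forth back
      where
      forth : UnionOf q z → ∃[ i ] ¬ UnionOf (part q i) z
      forth (inj₁ ∉) with proj₁ (proj₂ (proj₂ ∉𝒞ω-family)) (q ! 0) z ∉
      ... | j , p = pair 0 j , λ u → to (UnionOf-outside _ z) (subst (λ w → UnionOf w z) (part-pair-zero q j) u) p
      forth (inj₂ (m , lt , r)) with to (R-chd (listed q m) (proj₁ z)) r
      ... | j , ¬r = pair (suc m) j , λ u → ¬r (subst (λ k → R k (proj₁ z)) (nd-pair (listed q m) j)
                       (to (UnionOf-singleton (pair (listed q m) j) z) (subst (λ w → UnionOf w z) (part-pair-suc q m j lt) u)))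
      back : (∃[ i ] ¬ UnionOf (part q i) z) → UnionOf q z
      back (i , ¬u) with part-view q i
      ... | part-outside e = inj₁ (proj₂ (proj₂ (proj₂ ∉𝒞ω-family)) (q ! 0) z (snd i)
              (double-negation λ ¬p → ¬u (subst (λ w → UnionOf w z) (sym e) (from (UnionOf-outside _ z) ¬p))))
      ... | part-child m lt e = inj₂ (m , lt , from (R-chd (listed q m) (proj₁ z)) (snd i , λ r →
              ¬u (subst (λ w → UnionOf w z) (sym e) (from (UnionOf-singleton _ z)
                (subst (λ k → R k (proj₁ z)) (sym (nd-pair (listed q m) (snd i))) r)))))
      ... | part-padding e = ⊥-elim (¬u (subst (λ w → UnionOf w z) (sym e) (UnionOf-zero z)))

    -- A Σ⁰₁ description that agrees with `UnionOf q` when all listed nodes are basic; it then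
    -- supplies a basic code.
    Leaf : El (ω ⊗ 𝒞ω) → Set
    Leaf (q , z) = ¬ N 𝒞ω (q ! 0) z ⊎ (∃[ m ] m < q ! 2 × (∃[ j ] N 𝒞 (Δ (listed q m) (suc j)) (proj₁ z)))

    Mixed : ℕ → Set
    Mixed q = ∃[ m ] m < q ! 2 × Δ (listed q m) 0 ≡ 1

    -- The first entry of the code of q. It is computable since `Δ` is recursive and every code
    -- begins with 0 or 1.
    kind : ℕ → ℕ
    kind q = bit (truth (Mixed q))

    Δ-kind : ∀ n → Δ n 0 ≡ 0 ⊎ Δ n 0 ≡ 1
    Δ-kind n with node n
    ... | ⟨ basic _ _ 0≡ ⟩ = inj₁ 0≡
    ... | ⟨ union _ 1≡ _ _ _ _ _ ⟩ = inj₂ 1≡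

    unmixed : ∀ q → ¬ Mixed q → ∀ m → m < q ! 2 → Δ (listed q m) 0 ≡ 0
    unmixed q ¬mixed m lt with Δ-kind (listed q m)
    ... | inj₁ e = e
    ... | inj₂ e = ⊥-elim (¬mixed (m , lt , e))

    opaque
      leaf-family : Enumeration {𝒞ω} Leaf
      leaf-family = fibre-enum (substΣ (π₂ᴹ ,ᴹ (π₁ᴹ !ᴹ constᴹ 0)) ∉𝒞ωΣ ∨Σ
        ∃Σ ((π₂ᴹ <Σ (π₁ᴹ ∘ᴹ π₁ᴹ !ᴹ constᴹ 2)) ∧Σ
          ∃Σ (∈Σ (π₁ᴹ ∘ᴹ π₂ᴹ ∘ᴹ π₁ᴹ ∘ᴹ π₁ᴹ)
                 (eval𝒩ᴹ (Δᴹ ∘ᴹ listedᴹ (π₁ᴹ ∘ᴹ π₁ᴹ ∘ᴹ π₁ᴹ) (π₂ᴹ ∘ᴹ π₁ᴹ)) (map₁ᴹ suc-recursive π₂ᴹ)))))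
        where
        ∉𝒞ωΣ : SigmaOne (𝒞ω ⊗ ω) (λ p → ¬ N 𝒞ω (proj₂ p) (proj₁ p))
        ∉𝒞ωΣ = resp-Σ (λ {p} (i , q) → proj₂ (proj₂ (proj₂ ∉𝒞ω-family)) (proj₂ p) (proj₁ p) i q)
                      (λ {p} → proj₁ (proj₂ (proj₂ ∉𝒞ω-family)) (proj₂ p) (proj₁ p))
          (∃Σ (∈Σ (π₁ᴹ ∘ᴹ π₁ᴹ) (map₂ᴹ (proj₁ (proj₂ ∉𝒞ω-family)) (π₂ᴹ ∘ᴹ π₁ᴹ) π₂ᴹ)))

      kindᴹ : RecMap ω ω kind
      kindᴹ = functionᴹ (resp-Σ (λ {p} → forth p) (λ {p} → back p)
        (((π₂ᴹ ≡Σ constᴹ 1) ∧Σ ∃Σ ((π₂ᴹ <Σ (π₁ᴹ ∘ᴹ π₁ᴹ !ᴹ constᴹ 2)) ∧Σ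
            (eval𝒩ᴹ (Δᴹ ∘ᴹ listedᴹ (π₁ᴹ ∘ᴹ π₁ᴹ) π₂ᴹ) (constᴹ 0) ≡Σ constᴹ 1))) ∨Σ
         ((π₂ᴹ ≡Σ constᴹ 0) ∧Σ ∀<Σ (π₁ᴹ !ᴹ constᴹ 2)
            (eval𝒩ᴹ (Δᴹ ∘ᴹ listedᴹ (π₁ᴹ ∘ᴹ π₁ᴹ) π₂ᴹ) (constᴹ 0) ≡Σ constᴹ 0))))
        where
        Kind : El (ω ⊗ ω) → Set
        Kind (q , v) = (v ≡ 1 × Mixed q) ⊎ (v ≡ 0 × (∀ m → m < q ! 2 → Δ (listed q m) 0 ≡ 0))
        forth : ∀ p → Kind p → kind (proj₁ p) ≡ proj₂ p
        forth (q , v) (inj₁ (refl , mixed)) = truth-true mixed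
        forth (q , v) (inj₂ (refl , none)) = truth-false λ (m , lt , e) → 0≢1+n (trans (sym (none m lt)) e)
        back : ∀ p → kind (proj₁ p) ≡ proj₂ p → Kind p
        back (q , v) e with em {P = Mixed q}
        ... | yes mixed = inj₁ (sym e , mixed)
        ... | no ¬mixed = inj₂ (sym e , unmixed q ¬mixed)

    -- Here e is a proposed index of the map from q and i to the code of `part q i`. If q is mixed,
    -- the tail of its code is the index `S ω (ω ⊗ ω) (e , q)` of this map for fixed q.
    unionCodeFrom : Baire → ℕ → Baire
    unionCodeFrom e q n = if0 n (kind q) (if0 (kind q) (proj₁ leaf-family q (pred n)) (S ω (ω ⊗ ω) (e , q) (pred n)))

    UnionUnfold : El (𝒩 ⊗ (ω ⊗ (ω ⊗ ω))) → Set
    UnionUnfold (e , q , i , k) = N 𝒩 k (unionCodeFrom e (part q i))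

    opaque
      unionCodeFromᴹ : RecMap (𝒩 ⊗ ω) 𝒩 (λ p → unionCodeFrom (proj₁ p) (proj₂ p))
      unionCodeFromᴹ = into𝒩ᴹ (if0ᴹ π₂ᴹ kind′ (if0ᴹ kind′
          (map₂ᴹ (proj₁ (proj₂ leaf-family)) (π₂ᴹ ∘ᴹ π₁ᴹ) (map₁ᴹ pred-recursive π₂ᴹ))
          (eval𝒩ᴹ (Sᴹ ω (ω ⊗ ω) ∘ᴹ π₁ᴹ) (map₁ᴹ pred-recursive π₂ᴹ))))
        where
        kind′ : RecMap ((𝒩 ⊗ ω) ⊗ ω) ω (λ p → kind (proj₂ (proj₁ p)))
        kind′ = kindᴹ ∘ᴹ π₂ᴹ ∘ᴹ π₁ᴹ

      UnionUnfoldΣ : SigmaOne (𝒩 ⊗ (ω ⊗ (ω ⊗ ω))) UnionUnfold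
      UnionUnfoldΣ = ∈Σ (unionCodeFromᴹ ∘ᴹ (π₁ᴹ ,ᴹ map₂ᴹ part-recursive (π₁ᴹ ∘ᴹ π₂ᴹ) (π₁ᴹ ∘ᴹ π₂ᴹ ∘ᴹ π₂ᴹ))) (π₂ᴹ ∘ᴹ π₂ᴹ ∘ᴹ π₂ᴹ)

    unionIndex : Baire
    unionIndex = proj₁ (recursion-theorem UnionUnfoldΣ)

    unionCode : ℕ → Baire
    unionCode = unionCodeFrom unionIndex

    unionCodeᴹ : RecMap ω 𝒩 unionCode
    unionCodeᴹ = unionCodeFromᴹ ∘ᴹ (pointᴹ (proj₁ (proj₂ (recursion-theorem UnionUnfoldΣ))) ,ᴹ idᴹ)

    unionCode-parts : ∀ q → kind q ≡ 1 → ∀ i → Apply ω 𝒩 (unionCode q ⋆) i (unionCode (part q i))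
    unionCode-parts q mixed i k = mk⇔
      (λ p → Σ-extensional (GΣ (ω ⊗ ω)) (agree , refl , refl)
               (to (S-section ω (ω ⊗ ω) unionIndex q (i , k)) (to (fix (q , i , k)) p)))
      (λ g → from (fix (q , i , k)) (from (S-section ω (ω ⊗ ω) unionIndex q (i , k))
               (Σ-extensional (GΣ (ω ⊗ ω)) ((λ n → sym (agree n)) , refl , refl) g)))
      where
      fix : ∀ x → UnionUnfold (unionIndex , x) ⇔ G (ω ⊗ (ω ⊗ ω)) (unionIndex , x)
      fix = proj₂ (proj₂ (recursion-theorem UnionUnfoldΣ))
      -- The two indices agree only pointwise, so `Σ-extensional` is what carries G from one to the
      -- other.
      agree : S ω (ω ⊗ ω) (unionIndex , q) ≗ (unionCode q ⋆)
      agree n = sym (cong (λ a → if0 a (proj₁ leaf-family q n) (S ω (ω ⊗ ω) (unionIndex , q) n)) mixed)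

    -- Ranks of the codes

    open IsStrictTotalOrder isStrictTotalOrder using () renaming (compare to ≺-cmp; trans to ≺-trans)

    infix 4 _≼_

    _≼_ : Carrier → Carrier → Set
    α ≼ β = α ≡ β ⊎ α ≺ β

    ≺-≼-trans : ∀ {α β δ} → α ≺ β → β ≼ δ → α ≺ δ
    ≺-≼-trans p (inj₁ refl) = p
    ≺-≼-trans p (inj₂ q)    = ≺-trans p q

    ≼-≺-trans : ∀ {α β δ} → α ≼ β → β ≺ δ → α ≺ δ
    ≼-≺-trans (inj₁ refl) q = q
    ≼-≺-trans (inj₂ p)    q = ≺-trans p q

    2≼-mono : ∀ {α β} → 2≼ α → α ≼ β → 2≼ β
    2≼-mono (η , 1≼η , lt) le = η , 1≼η , ≺-≼-trans lt le

    code-1≼ : ∀ {η δ} → BC η δ → 1≼ η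
    code-1≼ (basic 1≼η _ _) = 1≼η
    code-1≼ (union (η , _ , lt) _ _ _ _ _ _) = η , lt

    union-2≼ : ∀ ν → code ν 0 ≡ 1 → 2≼ rank ν
    union-2≼ ⟨ basic _ _ 0≡ ⟩ 1≡ = ⊥-elim (0≢1+n (trans (sym 0≡) 1≡))
    union-2≼ ⟨ union 2≼η _ _ _ _ _ _ ⟩ _ = 2≼η

    module Ranks
      (one-least : ∀ {ζ} → 1≼ ζ → one ≼ ζ)
      (ξ : Carrier) (1≼ξ : 1≼ ξ) (top-rank : ∀ i → rank (top i) ≼ ξ)
      where

      one≺ : ∀ {ζ} → 2≼ ζ → one ≺ ζ
      one≺ (η , 1≼η , lt) = ≼-≺-trans (one-least 1≼η) lt

      -- The children added to a basic node have rank `one`, which need not be below the rank of the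
      -- node; the bound 2≼ ζ makes it smaller than ζ.
      child-rank≺ : ∀ ν j {ζ} → 2≼ ζ → rank ν ≼ ζ → rank (child ν j) ≺ ζ
      child-rank≺ ⟨ basic _ _ _ ⟩ j 2≼ζ _ = one≺ 2≼ζ
      child-rank≺ ⟨ union _ _ _ _ _ lt _ ⟩ j _ le = ≺-≼-trans (proj₂ (lt j)) le

      child-rank≼ : ∀ ν j → rank ν ≼ ξ → rank (child ν j) ≼ ξ
      child-rank≼ ⟨ basic _ _ _ ⟩ j _ = one-least 1≼ξ
      child-rank≼ ⟨ union _ _ _ _ _ lt _ ⟩ j le = inj₂ (≺-≼-trans (proj₂ (lt j)) le)

      node-rank : ∀ n → rank (node n) ≼ ξ
      node-rank = <-rec _ λ n ih → subst (λ ν → rank ν ≼ ξ) (sym (node-build n)) (step n λ m lt → ih {m} lt)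
        where
        step : ∀ n → (∀ m → m < n → rank (node m) ≼ ξ) → rank (build node (unpair n)) ≼ ξ
        step n ih with unpair n | fst≤ n
        ... | zero  , i | _  = top-rank i
        ... | suc m , j | le = child-rank≼ (node m) j (ih m le)

      Bounded : ℕ → Carrier → Set
      Bounded q ζ = ∀ m → m < q ! 2 → rank (node (listed q m)) ≼ ζ

      bounded-empty : ∀ q {ζ} → q ! 2 ≡ 0 → Bounded q ζ
      bounded-empty q e m lt = ⊥-elim (m<n⇒n≢0 lt e)

      -- A part that lists a node lists just one child of a node of q, and the rank of this child
      -- serves as η; other parts list nothing and get `one`.
      part-bounded : ∀ q i {ζ} → 2≼ ζ → Bounded q ζ → ∃[ η ] 1≼ η × η ≺ ζ × Bounded (part q i) η
      part-bounded q i {ζ} 2≼ζ bound with part-view q i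
      ... | part-outside e = one , 1≼one , one≺ 2≼ζ ,
              bounded-empty (part q i) (trans (cong (λ w → w ! 2) e) (outside-length _))
      ... | part-padding e = one , 1≼one , one≺ 2≼ζ , bounded-empty (part q i) (cong (λ w → w ! 2) e)
      ... | part-child m lt e = rank ν , code-1≼ (bc ν) , child-rank≺ (node (listed q m)) (snd i) 2≼ζ (bound m lt) , below
        where
        ν : Node
        ν = child (node (listed q m)) (snd i)
        same : node (listed (part q i) 0) ≡ ν
        same = trans (cong node (trans (cong (λ w → listed w 0) e) (trans (singleton-listed _) (nd-pair (listed q m) (snd i)))))
                     (node-chd (listed q m) (snd i))
        below : Bounded (part q i) (rank ν)
        below m′ lt′ with subst (m′ <_) (trans (cong (λ w → w ! 2) e) (singleton-length _)) lt′
        ... | s≤s z≤n = inj₁ (cong rank same)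

      -- The level η may lie below ζ, since a basic code has level `one` whatever the bound.
      UnionBC : ℕ → Carrier → Set
      UnionBC q ζ = ∃[ η ] η ≼ ζ × Σ[ c ∈ BC η (unionCode q) ] (∀ z → ρ 𝒞ω c z ⇔ UnionOf q z)

      leaf-union : ∀ q z → ¬ Mixed q → Leaf (q , z) ⇔ UnionOf q z
      leaf-union q z ¬mixed = mk⇔
        [ inj₁ , (λ (m , lt , p) → inj₂ (m , lt , from (basic-R (listed q m) (proj₁ z) (unmixed q ¬mixed m lt)) p)) ]′
        [ inj₁ , (λ (m , lt , r) → inj₂ (m , lt , to (basic-R (listed q m) (proj₁ z) (unmixed q ¬mixed m lt)) r)) ]′

      -- Well-founded induction on the bound. A mixed q lists a union node of rank at most ζ, so ζ
      -- is at least 2 and can carry a union code, whose parts have smaller bounds.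
      unionBC : ∀ ζ → Acc _≺_ ζ → ∀ q → 1≼ ζ → Bounded q ζ → UnionBC q ζ
      unionBC ζ (acc rs) q 1≼ζ bound = split (em {P = Mixed q})
        where
        split : Dec (Mixed q) → UnionBC q ζ
        split (no ¬mixed) = one , one-least 1≼ζ , basic 1≼one ¬2≼one (truth-false ¬mixed) , λ z → mk⇔
          (λ (i , p) → to (leaf-union q z ¬mixed) (proj₂ (proj₂ (proj₂ leaf-family)) q z i
                         (subst (λ s → N 𝒞ω s z) (entry i) p)))
          (λ u → let i , p = proj₁ (proj₂ (proj₂ leaf-family)) q z (from (leaf-union q z ¬mixed) u)
                 in i , subst (λ s → N 𝒞ω s z) (sym (entry i)) p)
          where
          entry : ∀ i → unionCode q (suc i) ≡ proj₁ leaf-family q i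
          entry i = cong (λ a → if0 a (proj₁ leaf-family q i) (S ω (ω ⊗ ω) (unionIndex , q) i)) (truth-false ¬mixed)
        split (yes mixed@(m , lt , 1≡)) =
          ζ , inj₁ refl ,
          union 2≼ζ (truth-true mixed) (λ i → unionCode (part q i)) (λ i → proj₁ (sub i))
            (unionCode-parts q (truth-true mixed))
            (λ i → code-1≼ (proj₁ (proj₂ (proj₂ (sub i)))) ,
                   ≼-≺-trans (proj₁ (proj₂ (sub i))) (proj₁ (proj₂ (proj₂ (bounds i)))))
            (λ i → proj₁ (proj₂ (proj₂ (sub i)))) ,
          λ z → mk⇔
            (λ (i , ¬p) → from (UnionOf-parts q z) (i , λ u → ¬p (from (proj₂ (proj₂ (proj₂ (sub i))) z) u)))
            (λ u → let i , ¬p = to (UnionOf-parts q z) u in i , λ p → ¬p (to (proj₂ (proj₂ (proj₂ (sub i))) z) p))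
          where
          2≼ζ : 2≼ ζ
          2≼ζ = 2≼-mono (union-2≼ (node (listed q m)) 1≡) (bound m lt)
          bounds : ∀ i → ∃[ η ] 1≼ η × η ≺ ζ × Bounded (part q i) η
          bounds i = part-bounded q i 2≼ζ bound
          sub : ∀ i → UnionBC (part q i) (proj₁ (bounds i))
          sub i = let η , 1≼η , lt , b = bounds i in unionBC η (rs lt) (part q i) 1≼η b

      module _ (2≼ξ : 2≼ ξ) where

        listed-rank : ∀ q m → rank (node (listed q m)) ≺ ξ
        listed-rank q m = subst (λ ν → rank ν ≺ ξ) (sym (node-chd (fst (q ! 1 ! m)) (snd (q ! 1 ! m))))
          (child-rank≺ (node (fst (q ! 1 ! m))) (snd (q ! 1 ! m)) 2≼ξ (node-rank (fst (q ! 1 ! m))))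

        -- A maximum of finitely many ranks below ξ stays below ξ, whether ξ is a successor or a
        -- limit. This is where finiteness of the unions matters.
        finite-bound : (r : ℕ → Carrier) → (∀ m → r m ≺ ξ) → ∀ b → ∃[ ζ ] 1≼ ζ × ζ ≺ ξ × (∀ m → m < b → r m ≼ ζ)
        finite-bound r r≺ zero = one , 1≼one , one≺ 2≼ξ , λ _ ()
        finite-bound r r≺ (suc b) with finite-bound r r≺ b
        ... | ζ , 1≼ζ , ζ≺ξ , bound with ≺-cmp (r b) ζ
        ... | tri< lt _ _ = ζ , 1≼ζ , ζ≺ξ , λ m m< → [ bound m , (λ { refl → inj₂ lt }) ]′ (m<1+n⇒m<n∨m≡n m<)
        ... | tri≈ _ eq _ = ζ , 1≼ζ , ζ≺ξ , λ m m< → [ bound m , (λ { refl → inj₁ eq }) ]′ (m<1+n⇒m<n∨m≡n m<)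
        ... | tri> _ _ gt = r b , (ζ , gt) , r≺ b ,
                λ m m< → [ (λ m<b → inj₂ (≼-≺-trans (bound m m<b) gt)) , (λ { refl → inj₁ refl }) ]′ (m<1+n⇒m<n∨m≡n m<)

        unionBC≺ : ∀ q → ∃[ η ] η ≺ ξ × Σ[ c ∈ BC η (unionCode q) ] (∀ z → ρ 𝒞ω c z ⇔ UnionOf q z)
        unionBC≺ q with finite-bound (λ m → rank (node (listed q m))) (listed-rank q) (q ! 2)
        ... | ζ , 1≼ζ , ζ≺ξ , bound with unionBC ζ (wellFounded ζ) q 1≼ζ bound
        ... | η , η≼ζ , c , eq = η , ≼-≺-trans η≼ζ ζ≺ξ , c , eq

        -- v names a node whose set has to be avoided in order that the bit n of the membership sequence be 0
        -- (if a ≡ 0: the node nd n itself) or 1 (otherwise: one of its children).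
        Avoids : ℕ → ℕ → ℕ → Set
        Avoids n a v = (a ≡ 0 × v ≡ n) ⊎ (0 < a × fst v ≡ nd n)

        -- Here l is a neighbourhood of a point of 𝒞 × ω together with a membership sequence.
        -- Avoiding `UnionOf q` forces the point into `l ! 0` and the memberships into
        -- `N 𝒞 (l ! 1)`. The length is one more than the last place that the ball `l ! 1` can
        -- constrain.
        Witness : ℕ → ℕ → Set
        Witness l q = q ! 0 ≡ l ! 0 × q ! 2 ≡ suc (l ! 1 ! 2) × 0 < l ! 1 ! 1 ×
          (∀ n → n < q ! 2 → Reaches (l ! 1) n → Avoids n (l ! 1 ! 0 ! n) (q ! 1 ! n))

        opaque
          witness-enum : ∃[ θ ] Recursive₁ θ × (∀ i q → Witness (enum ReadsΣ i) q → ∃[ t ] θ t ≡ q) ×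
                         (∀ t → θ t ≡ 0 ⊎ (∃[ i ] Witness (enum ReadsΣ i) (θ t)))
          witness-enum = image-enum {D = λ i q → Witness (enum ReadsΣ i) q}
            ((#1 !ᴿ constant 0 ≡ᴿ l !ᴿ constant 0) ∧ᴿ
             (#1 !ᴿ constant 2 ≡ᴿ sucᴿ (l !ᴿ constant 1 !ᴿ constant 2)) ∧ᴿ
             (constant 0 <ᴿ l !ᴿ constant 1 !ᴿ constant 1) ∧ᴿ
             ∀<ᴿ (#1 !ᴿ constant 2)
               (Reachesᴿ (l′ !ᴿ constant 1) #0 ⇒ᴿ
                (((l′ !ᴿ constant 1 !ᴿ constant 0 !ᴿ #0 ≡ᴿ constant 0) ∧ᴿ (#2 !ᴿ constant 1 !ᴿ #0 ≡ᴿ #0)) ∨ᴿ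
                 ((constant 0 <ᴿ l′ !ᴿ constant 1 !ᴿ constant 0 !ᴿ #0) ∧ᴿ
                  (fstᴿ (#2 !ᴿ constant 1 !ᴿ #0) ≡ᴿ pairᴿ (sucᴿ (fstᴿ #0)) (sndᴿ #0))))))
            where
            l : Recursive {2} (λ v → enum ReadsΣ (lookup v zero))
            l = enumᴿ ReadsΣ #0
            l′ : Recursive {3} (λ v → enum ReadsΣ (lookup v (suc zero)))
            l′ = enumᴿ ReadsΣ #1

        θ : ℕ → ℕ
        θ = proj₁ witness-enum

        avoid : ∀ x n → ∃[ v ] Avoids n (bit (membership x n)) v × ¬ R (nd v) x
        avoid x n with em {P = R (nd n) x}
        ... | no ¬r = n , inj₁ (refl , refl) , ¬r
        ... | yes r with to (R-chd (nd n) x) r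
        ... | j , ¬q = pair (nd n) j , inj₂ (s≤s z≤n , fst-pair (nd n) j) , λ q → ¬q (subst (λ k → R k x) (nd-pair (nd n) j) q)

        avoids-sound : ∀ {x n a v} → Avoids n a v → ¬ R (nd v) x → bit (membership x n) ≡ sgn a
        avoids-sound (inj₁ (refl , refl)) ¬r = truth-false ¬r
        avoids-sound {x} {n} {suc _} {v} (inj₂ (_ , e)) ¬r =
          truth-true (from (R-chd (nd n) x) (snd v , λ q → ¬r (subst (λ k → R (chd k (snd v)) x) (sym e) q)))

        avoids-sgn : ∀ {n a b v} → b ≡ sgn a → Avoids n b v → Avoids n a v
        avoids-sgn {a = zero}  refl av = av
        avoids-sgn {a = suc _} refl (inj₂ (_ , e)) = inj₂ (s≤s z≤n , e)

        -- By Σ⁰₁-ness of `Reads`, its truth depends on a neighbourhood of z and finitely many bits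
        -- of the membership sequence. Each bit is certified by one avoided set, and the
        -- certificates together are the avoidance of a single finite union.
        reads-union : ∀ z → Reads (z , membership (proj₁ z)) ⇔ (∃[ t ] ¬ UnionOf (θ t) z)
        reads-union z@(x , k) = mk⇔ forth back
          where
          forth : Reads (z , membership x) → ∃[ t ] ¬ UnionOf (θ t) z
          forth rd with covered ReadsΣ rd
          ... | i , (z∈ , b∈) = t , λ u → avoided (subst (λ w → UnionOf w z) θt≡q u)
            where
            l u q : ℕ
            l = enum ReadsΣ i
            -- Unconstrained places below the length are also filled with avoided nodes, since the
            -- whole union has to omit z.
            u = proj₁ (code-prefix (λ n → proj₁ (avoid x n)) (suc (l ! 1 ! 2)))
            q = l ! 0 ▸ u ▸ suc (l ! 1 ! 2) ▸ 0
            q-length : q ! 2 ≡ suc (l ! 1 ! 2)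
            q-length = ▸-two (l ! 0) u (suc (l ! 1 ! 2)) 0
            q-entry : ∀ n → n < q ! 2 → q ! 1 ! n ≡ proj₁ (avoid x n)
            q-entry n lt = trans (cong (λ s → s ! n) (▸-one (l ! 0) u (suc (l ! 1 ! 2) ▸ 0)))
              (proj₂ (code-prefix (λ n → proj₁ (avoid x n)) (suc (l ! 1 ! 2))) (subst (n <_) q-length lt))
            ball-eq : SeqBall sgn (l ! 1) (λ n → bit (membership x n))
            ball-eq = N𝒞⇒SeqBall (l ! 1) b∈
            witness : Witness l q
            witness = ▸-zero (l ! 0) (u ▸ suc (l ! 1 ! 2) ▸ 0) , q-length , proj₁ ball-eq , λ n lt r →
              subst (Avoids n (l ! 1 ! 0 ! n)) (sym (q-entry n lt))
                (avoids-sgn (proj₂ ball-eq n r) (proj₁ (proj₂ (avoid x n))))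
            t : ℕ
            t = proj₁ (proj₁ (proj₂ (proj₂ witness-enum)) i q witness)
            θt≡q : θ t ≡ q
            θt≡q = proj₂ (proj₁ (proj₂ (proj₂ witness-enum)) i q witness)
            avoided : ¬ UnionOf q z
            avoided (inj₁ ∉) = ∉ (subst (λ s → N 𝒞ω s z) (sym (proj₁ witness)) z∈)
            avoided (inj₂ (m , lt , r)) = proj₂ (proj₂ (avoid x m)) (subst (λ v → R (nd v) x) (q-entry m lt) r)
          back : (∃[ t ] ¬ UnionOf (θ t) z) → Reads (z , membership x)
          back (t , ¬u) with proj₂ (proj₂ (proj₂ witness-enum)) t
          ... | inj₁ e = ⊥-elim (¬u (subst (λ w → UnionOf w z) (sym e) (UnionOf-zero z)))
          ... | inj₂ (i , e₀ , e₂ , pos , av) = sound ReadsΣ i (z∈ , b∈)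
            where
            l : ℕ
            l = enum ReadsΣ i
            z∈ : N 𝒞ω (l ! 0) z
            z∈ = double-negation λ ¬p → ¬u (inj₁ (subst (λ s → ¬ N 𝒞ω s z) (sym e₀) ¬p))
            b∈ : N 𝒞 (l ! 1) (membership x)
            b∈ = SeqBall⇒N𝒞 (l ! 1) (SeqBall-bound sgn (l ! 1) (pos , λ n lt r →
              let lt′ = subst (n <_) (sym e₂) lt
              in avoids-sound (av n lt′ r) λ q → ¬u (inj₂ (n , lt′ , q))))

        codesΣ : SigmaOne (ω ⊗ ω) (λ p → N 𝒩 (proj₂ p) (unionCode (θ (proj₁ p))))
        codesΣ = ∈Σ (unionCodeᴹ ∘ᴹ map₁ᴹ (proj₁ (proj₂ witness-enum)) π₁ᴹ) π₂ᴹ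

        readsCode : Baire
        readsCode n = if0 n 1 (proj₁ (index codesΣ) (pred n))

        readsCode-recursive : RecursivePoint 𝒩 readsCode
        readsCode-recursive = toΣ⁰₁ (valueΣ {h = λ c n → if0 n 1 (c (pred n))}
          (into𝒩ᴹ (if0ᴹ π₂ᴹ (constᴹ 1) (eval𝒩ᴹ π₁ᴹ (map₁ᴹ pred-recursive π₂ᴹ)))) _ (proj₁ (proj₂ (index codesΣ))))

        readsBC : BC ξ readsCode
        readsBC = union 2≼ξ refl (λ t → unionCode (θ t)) (λ t → proj₁ (unionBC≺ (θ t)))
          (λ t k → proj₂ (proj₂ (index codesΣ)) (t , k))
          (λ t → code-1≼ (proj₁ (proj₂ (proj₂ (unionBC≺ (θ t))))) , proj₁ (proj₂ (unionBC≺ (θ t))))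
          (λ t → proj₁ (proj₂ (proj₂ (unionBC≺ (θ t)))))

        readsBC-spec : ∀ z → ρ 𝒞ω readsBC z ⇔ Reads (z , membership (proj₁ z))
        readsBC-spec z = mk⇔
          (λ (t , ¬p) → from (reads-union z) (t , λ u → ¬p (from (proj₂ (proj₂ (proj₂ (unionBC≺ (θ t)))) z) u)))
          (λ rd → let t , ¬u = to (reads-union z) rd in t , λ p → ¬u (to (proj₂ (proj₂ (proj₂ (unionBC≺ (θ t)))) z) p))

      readable-Σ⁰ : Σ⁰ ξ 𝒞ω (λ z → Reads (z , membership (proj₁ z)))
      readable-Σ⁰ with em {P = 2≼ ξ}
      ... | yes 2≼ξ = readsCode 2≼ξ , readsCode-recursive 2≼ξ , readsBC 2≼ξ ,
                      (λ {z} → from (readsBC-spec 2≼ξ z)) , (λ {z} → to (readsBC-spec 2≼ξ z))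
      ... | no ¬2≼ξ = basic-Σ⁰ 1≼ξ ¬2≼ξ (AllBasic.readable all-basic)
        where
        all-basic : ∀ n → Δ n 0 ≡ 0
        all-basic n with Δ-kind n
        ... | inj₁ e = e
        ... | inj₂ e = ⊥-elim (¬2≼ξ (2≼-mono (union-2≼ (node n) e) (node-rank n)))

-- The first level, and the assembly of C, f and g

module _ (em : ExcludedMiddle 0ℓ) (Λ : CountableWellOrder) where
  open CountableWellOrder Λ
  open IsStrictTotalOrder isStrictTotalOrder using () renaming (compare to ≺-cmp; trans to ≺-trans)

  ¬≺⇒≼ : ∀ {η ξ} → ¬ ξ ≺ η → η ≡ ξ ⊎ η ≺ ξ
  ¬≺⇒≼ {η} {ξ} ¬gt with ≺-cmp η ξ
  ... | tri< lt _ _ = inj₂ lt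
  ... | tri≈ _ eq _ = inj₁ eq
  ... | tri> _ _ gt = ⊥-elim (¬gt gt)

  -- Descent along the well-order ends at the element standing for the ordinal 1, the level of basic
  -- codes.
  first-level : ∀ {ξ} → 1≼ ξ → ∃[ one ] 1≼ one × (∀ {η} → 1≼ η → ¬ η ≺ one)
  first-level {ξ} = descend ξ (wellFounded ξ)
    where
    descend : ∀ ξ → Acc _≺_ ξ → 1≼ ξ → ∃[ one ] 1≼ one × (∀ {η} → 1≼ η → ¬ η ≺ one)
    descend ξ (acc rs) 1≼ξ with em {P = 2≼ ξ}
    ... | yes (η , 1≼η , lt) = descend η (rs lt) 1≼η
    ... | no ¬2≼ξ = ξ , 1≼ξ , λ 1≼η lt → ¬2≼ξ (_ , 1≼η , lt)

theorem1p5 : ExcludedMiddle 0ℓ →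
    (𝒢 : GoodParametrization) (Λ : CountableWellOrder) →
    let open CountableWellOrder Λ
        open Borel 𝒢 Λ
    in
    (ξ ξ⁺ : Carrier) → 1≼ ξ → IsSuccessor ξ ξ⁺ →
    (B : Pred (El 𝒞) 0ℓ) → Π⁰ ξ⁺ 𝒞 B →
    Σ[ C ∈ Pred (El 𝒩) 0ℓ ]
    Σ[ f ∈ PartialFunction 𝒩 𝒞 ]
    Σ[ g ∈ PartialFunction 𝒞 𝒩 ]
    Σ[ C⊆ ∈ C ⊆ Domain f ]
    Σ[ B⊆ ∈ B ⊆ Domain g ]
      Π⁰₁ 𝒩 C
      × RecursiveOn f Σ⁰₁ C⊆
      × RecursiveOn g (Σ⁰ ξ) B⊆
      × BijectionOnto f C⊆ B
      × InverseOn f g C⊆ B⊆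
theorem1p5 em 𝒢 Λ ξ ξ⁺ 1≼ξ (ξ≺ξ⁺ , _) B (_ , (_ , _ , Borel.basic _ ¬2≼ξ⁺ _ , _) , _) =
  ⊥-elim (¬2≼ξ⁺ (ξ , 1≼ξ , ξ≺ξ⁺))
theorem1p5 em 𝒢 Λ ξ ξ⁺ 1≼ξ (ξ≺ξ⁺ , immediate) B
           (Q , (γ , γ-recursive , Borel.union _ _ δ η δ-value η≺ δ-code , Q≐) , B≐) =
  Labelling , point , labels , (λ _ → tt) , (λ _ → tt) ,
  ((λ α → ∃[ n ] Bad α n) , toΣ⁰₁ BadΣ , id , id) ,
  (_ , toΣ⁰₁ (graph decodePointᴹ) , λ _ _ → mk⇔ id id) ,
  (_ , readable-Σ⁰ , λ x∈B k → Reads-encode (B⇒tops x∈B) k) ,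
  record
    { maps-to    = λ {α} good → tops⇒B (labelling-top {α} good)
    ; injective  = λ {α} {α′} good good′ eq n → trans (sym (labelling-unique {α} good eq n))
                     (labelling-unique {α′} good′ (λ _ → refl) n)
    ; surjective = λ {y} y∈B → encodeLabels y , encode-labelling y (B⇒tops y∈B) , decode-encodeLabels y
    } ,
  λ {α} good _ eq → labelling-unique {α} good eq
  where
  open CountableWellOrder Λ
  open BorelTree em 𝒢 Λ
  level : ∃[ one ] 1≼ one × (∀ {η} → 1≼ η → ¬ η ≺ one)
  level = first-level em Λ 1≼ξ
  open Tree (proj₁ level) (proj₁ (proj₂ level)) (λ (η , 1≼η , lt) → proj₂ (proj₂ level) 1≼η lt)
            γ (fromΣ⁰₁ γ-recursive) (λ i → ⟨ δ-code i ⟩) δ-value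
  -- No level lies strictly between ξ and ξ⁺, so the children of the root have rank at most ξ.
  open Ranks (λ 1≼ζ → ¬≺⇒≼ em Λ (proj₂ (proj₂ level) 1≼ζ)) ξ 1≼ξ
             (λ i → ¬≺⇒≼ em Λ (immediate (proj₂ (η≺ i))))

  point : PartialFunction 𝒩 𝒞
  point = record
    { Domain      = λ _ → ⊤
    ; apply       = λ {α} _ → decodePoint α
    ; Domain-resp = λ _ _ → tt
    ; apply-cong  = λ _ _ eq n → cong (λ a → isPositive (fst a)) (eq n)
    }

  -- Labels exist at every point, so g can be total; `Reads-encode` computes it from the lower
  -- memberships only on B.
  labels : PartialFunction 𝒞 𝒩
  labels = record
    { Domain      = λ _ → ⊤
    ; apply       = λ {x} _ → encodeLabels x
    ; Domain-resp = λ _ _ → tt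
    ; apply-cong  = λ {x} {y} _ _ eq n → cong₂ pair (cong bit (eq n))
                      (label-unique (Label-resp {n = n} (λ i → sym (eq i)) (proj₂ (Label-total y n))))
    }

  -- B is the complement of a union of complements, that is, the intersection of the top sets.
  B⇒tops : ∀ {x} → B x → ∀ i → R (pair 0 i) x
  B⇒tops {x} x∈B i = double-negation λ ¬r → proj₁ B≐ x∈B (proj₂ Q≐ (i , λ r →
    ¬r (subst (λ ν → set ν x) (sym (node-top i)) r)))

  tops⇒B : ∀ {x} → (∀ i → R (pair 0 i) x) → B x
  tops⇒B {x} tops = proj₂ B≐ λ x∈Q → let i , ¬r = proj₁ Q≐ x∈Q in
    ¬r (subst (λ ν → set ν x) (node-top i) (tops i))
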